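{- Let $k,m,s$ be positive integers and let $\mathcal F$ be a family of $k$-multisets of $[m]$ such that no more than $s$ members of $\mathcal F$ are pairwise disjoint. If $m > (2k-1)s$, then \[|\mathcal F| \leq \binom{m+k-1}{k} - \binom{m-s+k-1}{k}.\] Equality holds if and only if $\mathcal F$ is the family of all $k$-multisets of $[m]$ that intersect a given set of size $s$.
   Context: A $k$-multiset of $[m]=\{1,\dots,m\}$ is a multiset of cardinality $k$ (counting repetitions) with elements from $[m]$; $\mathrm{m}(i,A)$ denotes the multiplicity of $i$ in $A$. The intersection of multisets $A,B$ is the multiset $C$ with $\mathrm{m}(i,C)=\min\{\mathrm{m}(i,A),\mathrm{m}(i,B)\}$ (a set is regarded as a multiset with all multiplicities one); two multisets are disjoint if their intersection is empty, and they intersect otherwise. -}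

module Defs where

open import Data.Nat using (ℕ; _⊓_; _≤_; _<_; _+_; _∸_; _*_)
open import Data.Nat.Combinatorics using (_C_)
open import Data.Fin using (Fin)
open import Data.Vec using (Vec; lookup; sum)
open import Data.Fin.Subset using (Subset; _∈_; ∣_∣)
open import Data.List using (List; length)
import Data.List.Membership.Propositional as LM
open import Data.List.Relation.Unary.All using (All)
open import Data.List.Relation.Unary.AllPairs using (AllPairs)
open import Data.List.Relation.Unary.Unique.Propositional using (Unique)
open import Data.Product using (Σ; _×_; ∃-syntax)
open import Relation.Binary.PropositionalEquality using (_≡_)

-- A multiset of elements of [m] = Fin m, given by its multiplicity vector:
-- m(i,A) = lookup A i.
Multiset : ℕ → Set
Multiset m = Vec ℕ m

card : ∀ {m} → Multiset m → ℕ
card A = sum A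

IsKMultiset : ∀ {m} → ℕ → Multiset m → Set
IsKMultiset k A = card A ≡ k

Disjoint : ∀ {m} → Multiset m → Multiset m → Set
Disjoint A B = ∀ i → lookup A i ⊓ lookup B i ≡ 0

-- the multiset A intersects the set S (a set viewed as a multiset with
-- multiplicities one): some i ∈ S has min(1, m(i,A)) ≠ 0, i.e. m(i,A) ≥ 1
IntersectsSet : ∀ {m} → Subset m → Multiset m → Set
IntersectsSet S A = ∃[ i ] (i ∈ S × 1 ≤ lookup A i)

IsFamily : (m k : ℕ) → List (Multiset m) → Set
IsFamily m k F = Unique F × All (IsKMultiset k) F

NoMoreThanPairwiseDisjoint : ∀ {m} → ℕ → List (Multiset m) → Set
NoMoreThanPairwiseDisjoint {m} s F =
  (G : List (Multiset m)) → Unique G → All (LM._∈ F) G → AllPairs Disjoint G →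
  length G ≤ s

IsAllMeeting : ∀ {m} → ℕ → Subset m → List (Multiset m) → Set
IsAllMeeting {m} k S F =
  (A : Multiset m) → (A LM.∈ F → IsKMultiset k A × IntersectsSet S A)
                   × (IsKMultiset k A × IntersectsSet S A → A LM.∈ F)

bound : (m k s : ℕ) → ℕ
bound m k s = ((m + k ∸ 1) C k) ∸ ((m ∸ s + k ∸ 1) C k)

{-# OPTIONS --safe #-}

-- The multiplicities of a k-multiset of [m] form a composition of k; its support, together with those
-- of the k - 1 inner positions of the composition that are not cuts, is a k-subset of [m+k-1].
-- Disjoint images come from disjoint multisets, so the theorem follows from Frankl's bound for
-- families of k-subsets of [n] without s + 1 pairwise disjoint members, where
-- n ≥ (2s+1)k - s.
--
-- For a family F that is stable under shifting towards a block of s + 1 elements, let H be the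
-- members avoiding the block and G_i the links of the members meeting it in its i-th element only.
-- Stability puts the shadow of H inside the smallest link G_0, whence |H| < s|G_0| or H is empty.
-- The G_i are nested and have no s + 1 pairwise disjoint representatives; averaging over
-- (2s+1)-tuples of disjoint (k-1)-sets gives s|G_0| + Σ|G_i| ≤ s·C(n-s-1, k-1). Adding up yields the bound,
-- and equality forces H and G_0 to be empty. Shifts preserve the hypotheses, and an extremal
-- family can be traced back through each shift.
module Submission where

open import Defs
open import Data.Bool using (Bool; true; false; _∧_; _∨_; not; T)
import Data.Bool.Properties as Bool
open import Data.Fin as Fin using (Fin; zero; suc; toℕ)
open import Data.Fin.Properties using (any?; toℕ<n; toℕ-fromℕ; toℕ-injective)
open import Data.Fin.Subset using (Subset; ∣_∣; ∁; _∈_; _∪_; _∩_; ⁅_⁆; ⊤; ⋃) renaming (⊥ to ∅)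
open import Data.Fin.Subset.Properties
  using (anySubset?; ∩-comm; ∩-idem; ∣⊥∣≡0; ∣⁅x⁆∣≡1; ∣⊤∣≡n; ∣∁p∣≡n∸∣p∣)
open import Data.List as List using (List; []; _∷_; length; map)
open import Data.List.Membership.Propositional using () renaming (_∈_ to _∈ᴸ_)
open import Data.List.Membership.Propositional.Properties using (∈-map⁺; ∈-map⁻)
open import Data.List.Properties
  using (length-take; length-map; length-tabulate; length-++; length-replicate; ∷-injective)
open import Data.List.Relation.Unary.All as All using (All; []; _∷_)
import Data.List.Relation.Unary.All.Properties as All
open import Data.List.Relation.Unary.AllPairs as AllPairs using (AllPairs; []; _∷_)
import Data.List.Relation.Unary.AllPairs.Properties as AllPairs
open import Data.List.Relation.Unary.Any using (here; there)
open import Data.List.Relation.Unary.Unique.Propositional using (Unique)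
open import Data.Nat
open import Data.Nat.Combinatorics using (_C_; nCk+nC[k+1]≡[n+1]C[k+1])
open import Data.Nat.Induction using (<-wellFounded)
open import Data.Nat.ListAction using (sum)
open import Data.Nat.Properties
open import Data.Nat.Tactic.RingSolver using (solve-∀)
open import Data.Product using (_×_; _,_; proj₁; proj₂; ∃; ∃-syntax)
open import Data.Sum using (_⊎_; inj₁; inj₂)
open import Data.Vec using ([]; _∷_; _++_; tabulate; splitAt; here; there)
import Data.Vec as Vec
import Data.Vec.Properties as Vec
open import Function using (_∘_; _⇔_; mk⇔)
open import Induction.WellFounded using (Acc; acc)
open import Level using (0ℓ)
open import Relation.Binary using (Rel; Symmetric)
open import Relation.Binary.PropositionalEquality
open import Relation.Nullary using (Dec; _×-dec_; ¬_; yes; no; does; contradiction)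
open import Relation.Nullary.Decidable using (dec-true; dec-false)

-- The range of `m` comes from the averaging step. With `l = k - 1`, the points outside a block of
-- size `s + 1` have room for `2s + 1` disjoint `l`-sets exactly when `n ≥ (2s+1)l + s + 1`, and for
-- `n = m + l` this reads `m > (2k-1)s`. The tuple length `2s + 1` is the largest weight of a set:
-- `s` for lying in `G_0`, plus one for each of the `s + 1` links. The term `s|G_0|` is there to
-- absorb `H`. Members with two or more points in the block need no estimate, since they always meet
-- the block minus its first point. Equality meets two obstacles. A family other than a star could a
-- priori shift to a star; a third set disjoint from two conflicting ones excludes this. Moreover,
-- the extremal set for `k`-subsets might contain inner positions of the composition, which belong
-- to no element of `[m]`. This is excluded because disjoint multisets can have intersecting images,
-- so the hypothesis on multisets says more than its translation to sets.

private variable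
  n p k s : ℕ

-- Sums over all subsets

∑ : (Subset n → ℕ) → ℕ
∑ {zero}  f = f []
∑ {suc n} f = ∑ (λ A → f (true ∷ A)) + ∑ (λ A → f (false ∷ A))

syntax ∑ (λ A → e) = ∑[ A ] e
infix 5 ∑

∑-cong : {f g : Subset n → ℕ} → (∀ A → f A ≡ g A) → ∑ f ≡ ∑ g
∑-cong {zero}  e = e []
∑-cong {suc n} e = cong₂ _+_ (∑-cong (e ∘ (true ∷_))) (∑-cong (e ∘ (false ∷_)))

∑-mono : {f g : Subset n → ℕ} → (∀ A → f A ≤ g A) → ∑ f ≤ ∑ g
∑-mono {zero}  e = e []
∑-mono {suc n} e = +-mono-≤ (∑-mono (e ∘ (true ∷_))) (∑-mono (e ∘ (false ∷_)))

∑-mono-< : {f g : Subset n → ℕ} → (∀ A → f A ≤ g A) → ∀ A → f A < g A → ∑ f < ∑ g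
∑-mono-< e []          lt = lt
∑-mono-< e (true ∷ A)  lt = +-mono-<-≤ (∑-mono-< (e ∘ (true ∷_)) A lt) (∑-mono (e ∘ (false ∷_)))
∑-mono-< e (false ∷ A) lt = +-mono-≤-< (∑-mono (e ∘ (true ∷_))) (∑-mono-< (e ∘ (false ∷_)) A lt)

∑-≤-≡ : {f g : Subset n → ℕ} → (∀ A → f A ≤ g A) → ∑ f ≡ ∑ g → ∀ A → f A ≡ g A
∑-≤-≡ {f = f} {g} e eq A with f A ≟ g A
... | yes q = q
... | no  q = contradiction eq (<⇒≢ (∑-mono-< e A (≤∧≢⇒< (e A) q)))

interchange : ∀ a b c d → (a + b) + (c + d) ≡ (a + c) + (b + d)
interchange = solve-∀

∑-+ : (f g : Subset n → ℕ) → ∑[ A ] (f A + g A) ≡ ∑ f + ∑ g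
∑-+ {zero}  f g = refl
∑-+ {suc n} f g = trans
  (cong₂ _+_ (∑-+ (f ∘ (true ∷_)) (g ∘ (true ∷_))) (∑-+ (f ∘ (false ∷_)) (g ∘ (false ∷_))))
  (interchange (∑ (f ∘ (true ∷_))) _ _ _)

∑-*ˡ : ∀ c (f : Subset n → ℕ) → ∑[ A ] (c * f A) ≡ c * ∑ f
∑-*ˡ {zero}  c f = refl
∑-*ˡ {suc n} c f = trans (cong₂ _+_ (∑-*ˡ c (f ∘ (true ∷_))) (∑-*ˡ c (f ∘ (false ∷_))))
  (sym (*-distribˡ-+ c (∑ (f ∘ (true ∷_))) _))

∑-*ʳ : ∀ (f : Subset n → ℕ) c → ∑[ A ] (f A * c) ≡ ∑ f * c
∑-*ʳ f c = trans (∑-cong (λ A → *-comm (f A) c)) (trans (∑-*ˡ c f) (*-comm c (∑ f)))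

∑-swap : (f : Subset n → Subset p → ℕ) → ∑[ A ] ∑[ B ] f A B ≡ ∑[ B ] ∑[ A ] f A B
∑-swap {zero}  f = refl
∑-swap {suc n} f = trans (cong₂ _+_ (∑-swap (f ∘ (true ∷_))) (∑-swap (f ∘ (false ∷_))))
  (sym (∑-+ (λ B → ∑[ A ] f (true ∷ A) B) _))

∑-++ : ∀ n {p} (f : Subset (n + p) → ℕ) → ∑ f ≡ ∑ {n} λ u → ∑ {p} λ v → f (u ++ v)
∑-++ zero    f = refl
∑-++ (suc n) f = cong₂ _+_ (∑-++ n (f ∘ (true ∷_))) (∑-++ n (f ∘ (false ∷_)))

-- Characteristic functions make membership decidable. Restricting to a given first coordinate is
-- composition with `true ∷_` or `false ∷_`, so induction on the ground set is direct.
Family : ℕ → Set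
Family n = Subset n → Bool

infix 4 _∋_
_∋_ : Family n → Subset n → Set
F ∋ A = F A ≡ true

𝟙 : Bool → ℕ
𝟙 true  = 1
𝟙 false = 0

𝟙-mono : ∀ {a b} → (a ≡ true → b ≡ true) → 𝟙 a ≤ 𝟙 b
𝟙-mono {false} f = z≤n
𝟙-mono {true} {b} f rewrite f refl = s≤s z≤n

𝟙-injective : ∀ {a b} → 𝟙 a ≡ 𝟙 b → a ≡ b
𝟙-injective {false} {false} e = refl
𝟙-injective {true}  {true}  e = refl

𝟙≤1 : ∀ b → 𝟙 b ≤ 1
𝟙≤1 true  = s≤s z≤n
𝟙≤1 false = z≤n

Bool-ext : ∀ {a b} → (a ≡ true → b ≡ true) → (b ≡ true → a ≡ true) → a ≡ b
Bool-ext {true}  {b}     f g = sym (f refl)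
Bool-ext {false} {true}  f g = g refl
Bool-ext {false} {false} f g = refl

size : Family n → ℕ
size F = ∑[ A ] 𝟙 (F A)

size-empty : ∀ n → size {n} (λ _ → false) ≡ 0
size-empty zero    = refl
size-empty (suc n) = cong₂ _+_ (size-empty n) (size-empty n)

size≡0⇒∌ : (F : Family n) → size F ≡ 0 → ∀ A → F A ≡ false
size≡0⇒∌ {n} F e A = 𝟙-injective (sym (∑-≤-≡ (λ _ → z≤n) (trans (size-empty n) (sym e)) A))

Uniform : ℕ → Family n → Set
Uniform k F = ∀ A → F ∋ A → ∣ A ∣ ≡ k

-- Disjointness of subsets

disj : Subset n → Subset n → Bool
disj []      []      = true
disj (a ∷ A) (b ∷ B) = not (a ∧ b) ∧ disj A B

Disj : Subset n → Subset n → Set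
Disj A B = disj A B ≡ true

disj-comm : (A B : Subset n) → disj A B ≡ disj B A
disj-comm []      []      = refl
disj-comm (a ∷ A) (b ∷ B) = cong₂ (λ x y → not x ∧ y) (Bool.∧-comm a b) (disj-comm A B)

Disj-sym : {A B : Subset n} → Disj A B → Disj B A
Disj-sym {A = A} {B} d = trans (disj-comm B A) d

disj-∪ˡ : (A B X : Subset n) → disj (A ∪ B) X ≡ disj A X ∧ disj B X
disj-∪ˡ []          []          []          = refl
disj-∪ˡ (true ∷ A)  (b ∷ B)     (true ∷ X)  = refl
disj-∪ˡ (false ∷ A) (true ∷ B)  (true ∷ X)  = sym (Bool.∧-zeroʳ (disj A X))
disj-∪ˡ (false ∷ A) (false ∷ B) (true ∷ X)  = disj-∪ˡ A B X
disj-∪ˡ (a ∷ A)     (b ∷ B)     (false ∷ X)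
  rewrite Bool.∧-zeroʳ a | Bool.∧-zeroʳ b | Bool.∧-zeroʳ (a ∨ b) = disj-∪ˡ A B X

∧-true⁻ : ∀ {a b} → a ∧ b ≡ true → a ≡ true × b ≡ true
∧-true⁻ {true} {true} e = refl , refl

∧-true⁺ : ∀ {a b} → a ≡ true → b ≡ true → a ∧ b ≡ true
∧-true⁺ refl refl = refl

Disj-∪⁻ : (A B X : Subset n) → Disj (A ∪ B) X → Disj A X × Disj B X
Disj-∪⁻ A B X d = ∧-true⁻ (trans (sym (disj-∪ˡ A B X)) d)

Disj-∪⁺ : (A B X : Subset n) → Disj A X → Disj B X → Disj (A ∪ B) X
Disj-∪⁺ A B X d e = trans (disj-∪ˡ A B X) (∧-true⁺ d e)

Disj-∅ : (A : Subset n) → Disj ∅ A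
Disj-∅ []      = refl
Disj-∅ (a ∷ A) = Disj-∅ A

Disj-++⁺ : {A B : Subset n} {X Y : Subset p} → Disj A B → Disj X Y → Disj (A ++ X) (B ++ Y)
Disj-++⁺ {A = []}    {[]}    d e = e
Disj-++⁺ {A = a ∷ A} {b ∷ B} d e with ∧-true⁻ {not (a ∧ b)} d
... | x , y = ∧-true⁺ x (Disj-++⁺ {A = A} {B} y e)

∣∁∣-∪ : (W B : Subset n) → Disj W B → ∣ ∁ (W ∪ B) ∣ + ∣ B ∣ ≡ ∣ ∁ W ∣
∣∁∣-∪ []          []          d = refl
∣∁∣-∪ (true ∷ W)  (false ∷ B) d = ∣∁∣-∪ W B d
∣∁∣-∪ (false ∷ W) (true ∷ B)  d = trans (+-suc _ _) (cong suc (∣∁∣-∪ W B d))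
∣∁∣-∪ (false ∷ W) (false ∷ B) d = cong suc (∣∁∣-∪ W B d)

∣++∣ : (A : Subset n) (B : Subset p) → ∣ A ++ B ∣ ≡ ∣ A ∣ + ∣ B ∣
∣++∣ []          B = refl
∣++∣ (true ∷ A)  B = cong suc (∣++∣ A B)
∣++∣ (false ∷ A) B = ∣++∣ A B

-- Counting sets of a given size that avoid or meet a set

ofSize : ℕ → Family n
ofSize k B = ∣ B ∣ ≡ᵇ k

avoiding : ℕ → Subset n → Family n
avoiding k W B = ofSize k B ∧ disj W B

meeting : ℕ → Subset n → Family n
meeting k W B = ofSize k B ∧ not (disj W B)

pascal : ∀ c k → c C k + c C suc k ≡ suc c C suc k
pascal c k = nCk+nC[k+1]≡[n+1]C[k+1] c k

size-avoiding : ∀ k (W : Subset n) → size (avoiding k W) ≡ ∣ ∁ W ∣ C k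
size-avoiding zero    []          = refl
size-avoiding (suc k) []          = refl
size-avoiding {suc n} k (true ∷ W) = cong₂ _+_
  (trans (∑-cong {n} (λ B → cong 𝟙 (Bool.∧-zeroʳ (suc ∣ B ∣ ≡ᵇ k)))) (size-empty n)) (size-avoiding k W)
size-avoiding {suc n} zero    (false ∷ W) = cong₂ _+_ (size-empty n) (size-avoiding zero W)
size-avoiding (suc k) (false ∷ W) =
  trans (cong₂ _+_ (size-avoiding k W) (size-avoiding (suc k) W)) (pascal ∣ ∁ W ∣ k)

avoiding-∅ : ∀ k (B : Subset n) → avoiding k ∅ B ≡ ofSize k B
avoiding-∅ k B = trans (cong (ofSize k B ∧_) (Disj-∅ B)) (Bool.∧-identityʳ _)

size-ofSize : ∀ n k → size (ofSize {n} k) ≡ n C k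
size-ofSize n k = begin
  size (ofSize {n} k)    ≡⟨ ∑-cong {n} (λ B → cong 𝟙 (sym (avoiding-∅ k B))) ⟩
  size (avoiding {n} k ∅) ≡⟨ size-avoiding k (∅ {n}) ⟩
  ∣ ∁ (∅ {n}) ∣ C k      ≡⟨ cong (_C k) (∣∁p∣≡n∸∣p∣ (∅ {n})) ⟩
  (n ∸ ∣ ∅ {n} ∣) C k    ≡⟨ cong (λ z → (n ∸ z) C k) (∣⊥∣≡0 n) ⟩
  n C k                  ∎
  where open ≡-Reasoning

size-meeting : ∀ k (W : Subset n) → size (meeting k W) ≡ (n C k) ∸ ((n ∸ ∣ W ∣) C k)
size-meeting {n} k W = sym (begin
  n C k ∸ (n ∸ ∣ W ∣) C k
    ≡⟨ cong₂ _∸_ (sym (size-ofSize n k)) (cong (_C k) (sym (∣∁p∣≡n∸∣p∣ W))) ⟩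
  size (ofSize {n} k) ∸ ∣ ∁ W ∣ C k
    ≡⟨ cong₂ _∸_ (trans (∑-cong split) (∑-+ (𝟙 ∘ meeting k W) _)) (sym (size-avoiding k W)) ⟩
  size (meeting k W) + size (avoiding k W) ∸ size (avoiding k W)
    ≡⟨ m+n∸n≡m _ (size (avoiding k W)) ⟩
  size (meeting k W) ∎)
  where
  open ≡-Reasoning
  split : ∀ B → 𝟙 (ofSize k B) ≡ 𝟙 (meeting k W B) + 𝟙 (avoiding k W B)
  split B with ofSize k B | disj W B
  ... | true  | true  = refl
  ... | true  | false = refl
  ... | false | _     = refl

-- Averaging over tuples of disjoint sets

𝟙*-cong : ∀ b {x y} → (b ≡ true → x ≡ y) → 𝟙 b * x ≡ 𝟙 b * y
𝟙*-cong true  e = cong (1 *_) (e refl)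
𝟙*-cong false e = refl

𝟙*-mono : ∀ b {x y} → (b ≡ true → x ≤ y) → 𝟙 b * x ≤ 𝟙 b * y
𝟙*-mono true  e = *-monoʳ-≤ 1 (e refl)
𝟙*-mono false e = z≤n

𝟙-∧ : ∀ a b → 𝟙 (a ∧ b) ≡ 𝟙 a * 𝟙 b
𝟙-∧ true  b = sym (*-identityˡ (𝟙 b))
𝟙-∧ false b = refl

≡ᵇ-true : ∀ m n → (m ≡ᵇ n) ≡ true → m ≡ n
≡ᵇ-true m n e = ≡ᵇ⇒≡ m n (subst T (sym e) _)

≡ᵇ-refl : ∀ n → (n ≡ᵇ n) ≡ true
≡ᵇ-refl zero    = refl
≡ᵇ-refl (suc n) = ≡ᵇ-refl n

avoiding⇒size : ∀ l (W B : Subset n) → avoiding l W ∋ B → ∣ B ∣ ≡ l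
avoiding⇒size l W B a = ≡ᵇ-true ∣ B ∣ l (proj₁ (∧-true⁻ {ofSize l B} a))

avoiding⇒Disj : ∀ l (W B : Subset n) → avoiding l W ∋ B → Disj W B
avoiding⇒Disj l W B a = proj₂ (∧-true⁻ {ofSize l B} a)

∣∁∣-avoiding : ∀ l (W B : Subset n) → avoiding l W ∋ B → ∣ ∁ (W ∪ B) ∣ ≡ ∣ ∁ W ∣ ∸ l
∣∁∣-avoiding l W B a = trans (sym (m+n∸n≡m _ l)) (cong (_∸ l)
  (trans (cong (_ +_) (sym (avoiding⇒size l W B a))) (∣∁∣-∪ W B (avoiding⇒Disj l W B a))))

-- Two disjoint `l`-sets outside `W` may be chosen in either order; this makes all positions of a
-- tuple equivalent.
avoiding-swap : ∀ l (W B B′ : Subset n) →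
  avoiding l W B ∧ avoiding l (W ∪ B) B′ ≡ avoiding l W B′ ∧ avoiding l (W ∪ B′) B
avoiding-swap l W B B′ rewrite disj-∪ˡ W B B′ | disj-∪ˡ W B′ B | disj-comm B′ B
  with ofSize l B | ofSize l B′ | disj W B | disj W B′
... | true  | true  | true  | true  = refl
... | true  | true  | true  | false = refl
... | true  | true  | false | true  = refl
... | true  | true  | false | false = refl
... | true  | false | true  | _     = refl
... | true  | false | false | _     = refl
... | false | true  | _     | true  = refl
... | false | true  | _     | false = refl
... | false | false | _     | _     = refl

-- Runs over ordered `r`-tuples of pairwise disjoint `l`-sets outside `W`. Sets already chosen are
-- added to `W`, which enforces disjointness one choice at a time.
∑-tuples : ℕ → ℕ → Subset n → (List (Subset n) → ℕ) → ℕ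
∑-tuples l zero    W φ = φ []
∑-tuples l (suc r) W φ = ∑ λ B → 𝟙 (avoiding l W B) * ∑-tuples l r (W ∪ B) (λ L → φ (B ∷ L))

#tuples : ℕ → ℕ → ℕ → ℕ
#tuples l zero    c = 1
#tuples l (suc r) c = (c C l) * #tuples l r (c ∸ l)

∑-tuples-const : ∀ l r (W : Subset n) c → ∑-tuples l r W (λ _ → c) ≡ c * #tuples l r ∣ ∁ W ∣
∑-tuples-const l zero    W c = sym (*-identityʳ c)
∑-tuples-const l (suc r) W c = begin
  (∑ λ B → 𝟙 (avoiding l W B) * ∑-tuples l r (W ∪ B) (λ _ → c))
    ≡⟨ ∑-cong (λ B → 𝟙*-cong (avoiding l W B) λ a → trans (∑-tuples-const l r (W ∪ B) c)
         (cong (λ z → c * #tuples l r z) (∣∁∣-avoiding l W B a))) ⟩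
  (∑ λ B → 𝟙 (avoiding l W B) * (c * t))  ≡⟨ ∑-*ʳ (𝟙 ∘ avoiding l W) (c * t) ⟩
  size (avoiding l W) * (c * t)           ≡⟨ cong (_* (c * t)) (size-avoiding l W) ⟩
  (∣ ∁ W ∣ C l) * (c * t)                 ≡⟨ assoc-comm (∣ ∁ W ∣ C l) c t ⟩
  c * ((∣ ∁ W ∣ C l) * t)                 ∎
  where
  open ≡-Reasoning
  t = #tuples l r (∣ ∁ W ∣ ∸ l)
  assoc-comm : ∀ x y z → x * (y * z) ≡ y * (x * z)
  assoc-comm = solve-∀

∑-tuples-+ : ∀ l r (W : Subset n) φ ψ →
  ∑-tuples l r W (λ L → φ L + ψ L) ≡ ∑-tuples l r W φ + ∑-tuples l r W ψ
∑-tuples-+ l zero    W φ ψ = refl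
∑-tuples-+ l (suc r) W φ ψ = trans
  (∑-cong λ B → trans
    (cong (𝟙 (avoiding l W B) *_) (∑-tuples-+ l r (W ∪ B) (λ L → φ (B ∷ L)) (λ L → ψ (B ∷ L))))
    (*-distribˡ-+ (𝟙 (avoiding l W B)) _ _))
  (∑-+ (λ B → 𝟙 (avoiding l W B) * ∑-tuples l r (W ∪ B) (λ L → φ (B ∷ L))) _)

∑-tuples-mono : ∀ l r (W : Subset n) φ ψ →
  (∀ L → length L ≡ r → AllPairs Disj L → All (Disj W) L → φ L ≤ ψ L) →
  ∑-tuples l r W φ ≤ ∑-tuples l r W ψ
∑-tuples-mono l zero    W φ ψ le = le [] refl [] []
∑-tuples-mono l (suc r) W φ ψ le = ∑-mono λ B → 𝟙*-mono (avoiding l W B) λ a →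
  ∑-tuples-mono l r (W ∪ B) _ _ λ L len dis av →
    le (B ∷ L) (cong suc len) (All.map (λ {X} → proj₂ ∘ Disj-∪⁻ W B X) av ∷ dis)
      (avoiding⇒Disj l W B a ∷ All.map (λ {X} → proj₁ ∘ Disj-∪⁻ W B X) av)

-- By symmetry each of the `suc q` positions contributes equally. In the induction the head gives
-- its own share; the tail gives a double sum over `B` and `B′`, in which `avoiding-swap` exchanges
-- the two roles.
∑-tuples-sum : ∀ l q (W : Subset n) h →
  ∑-tuples l (suc q) W (sum ∘ map h)
    ≡ (suc q * #tuples l q (∣ ∁ W ∣ ∸ l)) * (∑ λ B → 𝟙 (avoiding l W B) * h B)
∑-tuples-sum l zero W h = trans
  (∑-cong λ B → cong (𝟙 (avoiding l W B) *_) (+-identityʳ (h B))) (sym (*-identityˡ _))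
∑-tuples-sum {n} l (suc q) W h = begin
  (∑ λ B → a B * ∑-tuples l (suc q) (W ∪ B) (λ L → h B + sum (map h L)))
    ≡⟨ ∑-cong (λ B → 𝟙*-cong (avoiding l W B) (step B)) ⟩
  (∑ λ B → a B * (h B * ((c C l) * t) + (suc q * t) * a′ B))
    ≡⟨ ∑-cong (λ B → distr (a B) (h B) ((c C l) * t) (suc q * t) (a′ B)) ⟩
  (∑ λ B → a B * h B * ((c C l) * t) + (suc q * t) * (a B * a′ B))
    ≡⟨ ∑-+ (λ B → a B * h B * ((c C l) * t)) _ ⟩
  (∑ λ B → a B * h B * ((c C l) * t)) + (∑ λ B → (suc q * t) * (a B * a′ B))
    ≡⟨ cong₂ _+_ (∑-*ʳ (λ B → a B * h B) _) (∑-*ˡ (suc q * t) (λ B → a B * a′ B)) ⟩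
  X * ((c C l) * t) + (suc q * t) * (∑ λ B → a B * a′ B)
    ≡⟨ cong (λ z → X * ((c C l) * t) + (suc q * t) * z) pairs ⟩
  X * ((c C l) * t) + (suc q * t) * (X * (c C l))
    ≡⟨ collect X (c C l) t q ⟩
  (suc (suc q) * ((c C l) * t)) * X ∎
  where
  open ≡-Reasoning
  c = ∣ ∁ W ∣ ∸ l
  t = #tuples l q (c ∸ l)
  a a′ : Subset n → ℕ
  a B = 𝟙 (avoiding l W B)
  a′ B = ∑ λ B′ → 𝟙 (avoiding l (W ∪ B) B′) * h B′
  X = ∑ λ B → a B * h B
  distr : ∀ a h u v w → a * (h * u + v * w) ≡ a * h * u + v * (a * w)
  distr = solve-∀
  collect : ∀ X c t q → X * (c * t) + (suc q * t) * (X * c) ≡ (suc (suc q) * (c * t)) * X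
  collect = solve-∀
  step : ∀ B → avoiding l W ∋ B → ∑-tuples l (suc q) (W ∪ B) (λ L → h B + sum (map h L))
    ≡ h B * ((c C l) * t) + (suc q * t) * a′ B
  step B av = trans (∑-tuples-+ l (suc q) (W ∪ B) (λ _ → h B) (sum ∘ map h)) (cong₂ _+_
    (trans (∑-tuples-const l (suc q) (W ∪ B) (h B)) (cong (λ z → h B * #tuples l (suc q) z) co))
    (trans (∑-tuples-sum l q (W ∪ B) h) (cong (λ z → (suc q * #tuples l q (z ∸ l)) * a′ B) co)))
    where
    co = ∣∁∣-avoiding l W B av
  exchange : ∀ B B′ → a B * (𝟙 (avoiding l (W ∪ B) B′) * h B′)
    ≡ a B′ * h B′ * 𝟙 (avoiding l (W ∪ B′) B)
  exchange B B′ = begin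
    a B * (𝟙 (avoiding l (W ∪ B) B′) * h B′)    ≡⟨ *-assoc (a B) _ (h B′) ⟨
    a B * 𝟙 (avoiding l (W ∪ B) B′) * h B′      ≡⟨ cong (_* h B′) (𝟙-∧ (avoiding l W B) _) ⟨
    𝟙 (avoiding l W B ∧ avoiding l (W ∪ B) B′) * h B′
      ≡⟨ cong (λ z → 𝟙 z * h B′) (avoiding-swap l W B B′) ⟩
    𝟙 (avoiding l W B′ ∧ avoiding l (W ∪ B′) B) * h B′
      ≡⟨ cong (_* h B′) (𝟙-∧ (avoiding l W B′) _) ⟩
    a B′ * 𝟙 (avoiding l (W ∪ B′) B) * h B′     ≡⟨ swapʳ (a B′) _ (h B′) ⟩
    a B′ * h B′ * 𝟙 (avoiding l (W ∪ B′) B)     ∎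
    where
    swapʳ : ∀ x y z → x * y * z ≡ x * z * y
    swapʳ = solve-∀
  pairs : (∑ λ B → a B * a′ B) ≡ X * (c C l)
  pairs = begin
    (∑ λ B → a B * a′ B)
      ≡⟨ ∑-cong (λ B → trans (sym (∑-*ˡ {n} (a B) _)) (∑-cong (exchange B))) ⟩
    (∑ λ B → ∑ λ B′ → a B′ * h B′ * 𝟙 (avoiding l (W ∪ B′) B))
      ≡⟨ ∑-swap (λ B B′ → a B′ * h B′ * 𝟙 (avoiding l (W ∪ B′) B)) ⟩
    (∑ λ B′ → ∑ λ B → a B′ * h B′ * 𝟙 (avoiding l (W ∪ B′) B))
      ≡⟨ ∑-cong (λ B′ → trans (∑-*ˡ {n} (a B′ * h B′) _) (cong (a B′ * h B′ *_) (size-avoiding l (W ∪ B′)))) ⟩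
    (∑ λ B′ → a B′ * h B′ * (∣ ∁ (W ∪ B′) ∣ C l))
      ≡⟨ ∑-cong (λ B′ → trans (*-assoc (a B′) (h B′) _) (trans
           (𝟙*-cong (avoiding l W B′) (λ av → cong (λ z → h B′ * (z C l)) (∣∁∣-avoiding l W B′ av)))
           (sym (*-assoc (a B′) (h B′) _)))) ⟩
    (∑ λ B′ → a B′ * h B′ * (c C l))
      ≡⟨ ∑-*ʳ (λ B′ → a B′ * h B′) (c C l) ⟩
    X * (c C l) ∎

nCk>0 : ∀ n k → k ≤ n → 0 < n C k
nCk>0 n       zero    le       = s≤s z≤n
nCk>0 (suc n) (suc k) (s≤s le) =
  subst (0 <_) (pascal n k) (≤-trans (nCk>0 n k le) (m≤m+n (n C k) _))

#tuples>0 : ∀ l r c → r * l ≤ c → 0 < #tuples l r c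
#tuples>0 l zero    c le = s≤s z≤n
#tuples>0 l (suc r) c le = *-mono-≤ (nCk>0 c l (≤-trans (m≤m+n l (r * l)) le))
  (#tuples>0 l r (c ∸ l) (≤-trans (≤-reflexive (sym (m+n∸m≡n l (r * l)))) (∸-monoˡ-≤ l le)))

-- Every `l`-set lies in equally many tuples, so a bound for each tuple bounds the average. The room
-- hypothesis makes the number of tuples positive, which allows the division.
averaging : ∀ l q c (h : Subset n → ℕ) → suc q * l ≤ n →
  (∀ L → length L ≡ suc q → AllPairs Disj L → sum (map h L) ≤ suc q * c) →
  (∑ λ B → 𝟙 (ofSize l B) * h B) ≤ c * (n C l)
averaging {n} l q c h le bd = *-cancelˡ-≤ (suc q * t) {{>-nonZero pos}} (begin
  suc q * t * (∑ λ B → 𝟙 (ofSize l B) * h B)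
    ≡⟨ cong (suc q * t *_) (∑-cong (λ B → cong (λ z → 𝟙 z * h B) (avoiding-∅ l B))) ⟨
  suc q * t * (∑ λ B → 𝟙 (avoiding l ∅ B) * h B)
    ≡⟨ cong (λ z → suc q * #tuples l q (z ∸ l) * (∑ λ B → 𝟙 (avoiding l ∅ B) * h B)) co ⟨
  suc q * #tuples l q (∣ ∁ (∅ {n}) ∣ ∸ l) * (∑ λ B → 𝟙 (avoiding l ∅ B) * h B)
    ≡⟨ ∑-tuples-sum l q ∅ h ⟨
  ∑-tuples l (suc q) (∅ {n}) (sum ∘ map h)
    ≤⟨ ∑-tuples-mono l (suc q) ∅ _ (λ _ → suc q * c) (λ L len dis _ → bd L len dis) ⟩
  ∑-tuples l (suc q) (∅ {n}) (λ _ → suc q * c)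
    ≡⟨ ∑-tuples-const l (suc q) (∅ {n}) (suc q * c) ⟩
  suc q * c * #tuples l (suc q) ∣ ∁ (∅ {n}) ∣
    ≡⟨ cong (λ z → suc q * c * #tuples l (suc q) z) co ⟩
  suc q * c * ((n C l) * t)
    ≡⟨ regroup (suc q) c (n C l) t ⟩
  suc q * t * (c * (n C l)) ∎)
  where
  open ≤-Reasoning
  t = #tuples l q (n ∸ l)
  co : ∣ ∁ (∅ {n}) ∣ ≡ n
  co = trans (∣∁p∣≡n∸∣p∣ (∅ {n})) (cong (n ∸_) (∣⊥∣≡0 n))
  pos : 0 < suc q * t
  pos = *-mono-≤ {1} {suc q} (s≤s z≤n) (#tuples>0 l q (n ∸ l)
    (≤-trans (≤-reflexive (sym (m+n∸m≡n l (q * l)))) (∸-monoˡ-≤ l le)))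
  regroup : ∀ a c d t → a * c * (d * t) ≡ a * t * (c * d)
  regroup = solve-∀

-- Nested cross-dependent families

module _ {A : Set} {R : Rel A 0ℓ} (R-sym : Symmetric R) where

  -- Removal of `x` is recorded through its effect on all sums, so that the counts of the other
  -- families can be compared before and after.
  extract : (Q : A → Bool) (L : List A) → AllPairs R L →
    sum (map (𝟙 ∘ Q) L) ≡ 0 ⊎ ∃[ x ] ∃[ L′ ] (Q x ≡ true × x ∈ᴸ L × All (R x) L′ × AllPairs R L′
      × (∀ (g : A → ℕ) → sum (map g L) ≡ g x + sum (map g L′)) × (∀ {y} → y ∈ᴸ L′ → y ∈ᴸ L))
  extract Q []      []       = inj₁ refl
  extract Q (x ∷ L) (r ∷ rs) with Q x in eq
  ... | true  = inj₂ (x , L , eq , here refl , r , rs , (λ g → refl) , there)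
  ... | false with extract Q L rs
  ...   | inj₁ e = inj₁ e
  ...   | inj₂ (y , L′ , Qy , y∈ , ry , rs′ , sums , sub) =
    inj₂ (y , x ∷ L′ , Qy , there y∈ , R-sym (All.lookup r y∈) ∷ ry
      , All.tabulate (λ z∈ → All.lookup r (sub z∈)) ∷ rs′
      , (λ g → trans (cong (g x +_) (sums g)) (rotate (g x) (g y) _))
      , λ { (here e) → here e ; (there z∈) → there (sub z∈) })
    where
    rotate : ∀ a b c → a + (b + c) ≡ b + (a + c)
    rotate = solve-∀

  -- Hall's theorem for families that will be increasing in i: only the counts of single families matter.
  greedy-transversal : ∀ {r} (G : Fin r → A → Bool) (L : List A) → AllPairs R L →
    (∃[ i ] sum (map (𝟙 ∘ G i) L) ≤ toℕ i) ⊎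
    ∃ λ (u : Fin r → A) →
      (∀ i → G i (u i) ≡ true) × (∀ i j → i ≢ j → R (u i) (u j)) × (∀ i → u i ∈ᴸ L)
  greedy-transversal {zero}  G L rs = inj₂ ((λ ()) , (λ ()) , (λ ()) , (λ ()))
  greedy-transversal {suc r} G L rs with extract (G zero) L rs
  ... | inj₁ e = inj₁ (zero , ≤-reflexive e)
  ... | inj₂ (x , L′ , Gx , x∈ , rx , rs′ , sums , sub) with greedy-transversal (G ∘ suc) L′ rs′
  -- Choosing `x` costs `G (suc i)` at most one member of the list, which the threshold
  -- `toℕ (suc i)` allows for.
  ...   | inj₁ (i , le) = inj₁ (suc i ,
            ≤-trans (≤-reflexive (sums (𝟙 ∘ G (suc i)))) (+-mono-≤ (𝟙≤1 (G (suc i) x)) le))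
  ...   | inj₂ (u , Gu , ru , u∈) = inj₂ (v , Gv , rv , v∈)
    where
    v : Fin (suc r) → A
    v zero    = x
    v (suc i) = u i
    Gv : ∀ i → G i (v i) ≡ true
    Gv zero    = Gx
    Gv (suc i) = Gu i
    rv : ∀ i j → i ≢ j → R (v i) (v j)
    rv zero    zero    ne = contradiction refl ne
    rv zero    (suc j) ne = All.lookup rx (u∈ j)
    rv (suc i) zero    ne = R-sym (All.lookup rx (u∈ i))
    rv (suc i) (suc j) ne = ru i j (ne ∘ cong suc)
    v∈ : ∀ i → v i ∈ᴸ L
    v∈ zero    = x∈
    v∈ (suc i) = sub (u∈ i)

∑ᶠ : (Fin n → ℕ) → ℕ
∑ᶠ g = Vec.sum (tabulate g)

∑ᶠ𝟙≤ : (g : Fin n → Bool) → ∑ᶠ (𝟙 ∘ g) ≤ n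
∑ᶠ𝟙≤ {zero}  g = z≤n
∑ᶠ𝟙≤ {suc n} g = +-mono-≤ (𝟙≤1 (g zero)) (∑ᶠ𝟙≤ (g ∘ suc))

∑ᶠ𝟙-increasing : (g : Fin n) (b : Fin n → Bool) → (∀ i → i Fin.≤ g → b i ≡ false) →
  ∑ᶠ (𝟙 ∘ b) + suc (toℕ g) ≤ n
∑ᶠ𝟙-increasing {suc n} zero    b off rewrite off zero z≤n =
  ≤-trans (≤-reflexive (+-comm _ 1)) (s≤s (∑ᶠ𝟙≤ (b ∘ suc)))
∑ᶠ𝟙-increasing {suc n} (suc g) b off rewrite off zero z≤n =
  ≤-trans (≤-reflexive (+-suc _ _)) (s≤s (∑ᶠ𝟙-increasing g (b ∘ suc) (λ i le → off (suc i) (s≤s le))))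

Transversal : (Fin s → Family n) → Set
Transversal {s} {n} G =
  ∃ λ (u : Fin s → Subset n) → (∀ i → G i ∋ u i) × (∀ i j → i ≢ j → Disj (u i) (u j))

-- The factor `s` makes the largest weight `s + (s + 1)` equal to the tuple length `2s + 1`; this
-- balance is what `cross-dependent` exploits.
weight : (Fin (suc s) → Family n) → Subset n → ℕ
weight {s} G u = s * 𝟙 (G zero u) + ∑ᶠ (λ i → 𝟙 (G i u))

module _ (G : Fin (suc s) → Family n)
         (G-mono : ∀ i j → i Fin.≤ j → ∀ u → G i ∋ u → G j ∋ u) where

  private
    absent : ∀ i j → j Fin.≤ i → ∀ u → G i u ≡ false → G j u ≡ false
    absent i j le u e with G j u in eq
    ... | false = refl
    ... | true  = trans (sym (G-mono j i le u eq)) e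

  -- A set outside `G i` is, by nestedness, outside all earlier families including `G zero`, so only
  -- `s - i` memberships remain. For a set in `G i` the trivial maximum is used.
  weight-≤ : ∀ i u → weight G u ≤ (s ∸ toℕ i) + 𝟙 (G i u) * (2 * s + 1)
  weight-≤ i u with G i u in eq
  ... | true  = ≤-trans
    (+-mono-≤ (*-monoʳ-≤ s (𝟙≤1 (G zero u))) (∑ᶠ𝟙≤ (λ j → G j u)))
    (≤-trans (≤-reflexive (full s)) (m≤n+m _ (s ∸ toℕ i)))
    where
    full : ∀ s → s * 1 + suc s ≡ 1 * (2 * s + 1)
    full = solve-∀
  ... | false = begin
    s * 𝟙 (G zero u) + ∑ᶠ (λ j → 𝟙 (G j u))
      ≡⟨ cong (λ b → s * 𝟙 b + ∑ᶠ (λ j → 𝟙 (G j u))) (absent i zero z≤n u eq) ⟩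
    s * 0 + ∑ᶠ (λ j → 𝟙 (G j u))
      ≡⟨ cong (_+ ∑ᶠ (λ j → 𝟙 (G j u))) (*-zeroʳ s) ⟩
    ∑ᶠ (λ j → 𝟙 (G j u))
      ≤⟨ m+n≤o⇒m≤o∸n _ (≤-pred (≤-trans (≤-reflexive (sym (+-suc _ (toℕ i))))
           (∑ᶠ𝟙-increasing i (λ j → G j u) (λ j le → absent i j le u eq)))) ⟩
    s ∸ toℕ i
      ≡⟨ +-identityʳ _ ⟨
    (s ∸ toℕ i) + 0 ∎
    where open ≤-Reasoning

  sum-weight-≤ : ∀ i (L : List (Subset n)) →
    sum (map (weight G) L) ≤ length L * (s ∸ toℕ i) + sum (map (𝟙 ∘ G i) L) * (2 * s + 1)
  sum-weight-≤ i []      = z≤n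
  sum-weight-≤ i (u ∷ L) = ≤-trans (+-mono-≤ (weight-≤ i u) (sum-weight-≤ i L))
    (≤-reflexive (regroup (s ∸ toℕ i) (𝟙 (G i u)) (2 * s + 1) (length L) (sum (map (𝟙 ∘ G i) L))))
    where
    regroup : ∀ d a c x y → (d + a * c) + (x * d + y * c) ≡ (d + x * d) + (a + y) * c
    regroup = solve-∀

  -- In a tuple of `2s + 1` disjoint sets, the absence of a transversal gives an `i` with at most
  -- `i` members in `G i`. The total weight is then at most `(2s+1)(s-i) + i(2s+1) = (2s+1)s`,
  -- whatever `i` is.
  cross-dependent : ∀ l → (2 * s + 1) * l ≤ n → (∀ i → Uniform l (G i)) → ¬ Transversal G →
    ∑ (weight G) ≤ s * (n C l)
  cross-dependent l le unif none = ≤-trans (≤-reflexive (∑-cong on-l-sets))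
    (averaging l (2 * s) s (weight G) (subst (λ z → z * l ≤ n) (+-comm (2 * s) 1) le) bounded)
    where
    bounded : ∀ L → length L ≡ suc (2 * s) → AllPairs Disj L → sum (map (weight G) L) ≤ suc (2 * s) * s
    bounded L len dis with greedy-transversal (λ {A} {B} → Disj-sym {A = A} {B}) G L dis
    ... | inj₂ (u , Gu , du , _) = contradiction (u , Gu , du) none
    ... | inj₁ (i , le) = begin
      sum (map (weight G) L)
        ≤⟨ sum-weight-≤ i L ⟩
      length L * (s ∸ toℕ i) + sum (map (𝟙 ∘ G i) L) * (2 * s + 1)
        ≤⟨ +-monoʳ-≤ _ (*-monoˡ-≤ (2 * s + 1) le) ⟩
      length L * (s ∸ toℕ i) + toℕ i * (2 * s + 1)
        ≡⟨ cong (λ z → z * (s ∸ toℕ i) + toℕ i * (2 * s + 1)) len ⟩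
      suc (2 * s) * (s ∸ toℕ i) + toℕ i * (2 * s + 1)
        ≡⟨ regroup (2 * s) (s ∸ toℕ i) (toℕ i) ⟩
      suc (2 * s) * ((s ∸ toℕ i) + toℕ i)
        ≡⟨ cong (suc (2 * s) *_) (m∸n+n≡m (≤-pred (toℕ<n i))) ⟩
      suc (2 * s) * s ∎
      where
      open ≤-Reasoning
      regroup : ∀ a d i → suc a * d + i * (a + 1) ≡ suc a * (d + i)
      regroup = solve-∀
    on-l-sets : ∀ u → weight G u ≡ 𝟙 (ofSize l u) * weight G u
    on-l-sets u with ofSize l u in eq
    ... | true  = sym (*-identityˡ _)
    -- For the last index the bound of `weight-≤` vanishes on a set that lies in no `G i`.
    ... | false = n≤0⇒n≡0 (≤-trans (weight-≤ (Fin.fromℕ s) u) (≤-reflexive vanish))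
      where
      G-off : ∀ i → G i u ≡ false
      G-off i with G i u in e
      ... | false = refl
      ... | true  = trans (sym (trans (cong (_≡ᵇ l) (unif i u e)) (≡ᵇ-refl l))) eq
      vanish : (s ∸ toℕ (Fin.fromℕ s)) + 𝟙 (G (Fin.fromℕ s) u) * (2 * s + 1) ≡ 0
      vanish rewrite G-off (Fin.fromℕ s) | toℕ-fromℕ s | n∸n≡0 s = refl

-- Shadows of stable families

infix 4 _⋖_
-- The covering relation of the Boolean lattice.
data _⋖_ : Subset n → Subset n → Set where
  here  : {A : Subset n} → false ∷ A ⋖ true ∷ A
  there : ∀ {b} {A B : Subset n} → A ⋖ B → b ∷ A ⋖ b ∷ B

-- Sets are shifted towards the end of the vector, the reverse of the usual convention.
data Move : Subset n → Subset n → Set where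
  here  : {A B : Subset n} → A ⋖ B → Move (true ∷ A) (false ∷ B)
  there : ∀ {b} {A B : Subset n} → Move A B → Move (b ∷ A) (b ∷ B)

Stable : Family n → Set
Stable F = ∀ {A B} → Move A B → F ∋ A → F ∋ B

-- Lists may contain repetitions. Only `∅` is disjoint from itself, so this bounds the matching
-- number and also keeps `∅` out of `F`.
Matching≤ : ℕ → Family n → Set
Matching≤ s F = ∀ L → All (F ∋_) L → AllPairs Disj L → length L ≤ s

⋖-size : {A B : Subset n} → A ⋖ B → ∣ B ∣ ≡ suc ∣ A ∣
⋖-size here                  = refl
⋖-size (there {b = true} c)  = cong suc (⋖-size c)
⋖-size (there {b = false} c) = ⋖-size c

∅⋖⁅_⁆ : (i : Fin n) → ∅ ⋖ ⁅ i ⁆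
∅⋖⁅ zero ⁆  = here
∅⋖⁅ suc i ⁆ = there ∅⋖⁅ i ⁆

++-⋖ : (u : Subset n) {A B : Subset p} → A ⋖ B → u ++ A ⋖ u ++ B
++-⋖ []      c = c
++-⋖ (b ∷ u) c = there (++-⋖ u c)

++-Move : (u : Subset n) {A B : Subset p} → Move A B → Move (u ++ A) (u ++ B)
++-Move []      c = c
++-Move (b ∷ u) c = there (++-Move u c)

Move-⁅⁆ : {i j : Fin n} → i Fin.< j → Move ⁅ i ⁆ ⁅ j ⁆
Move-⁅⁆ {i = zero}  {suc j} _       = here ∅⋖⁅ j ⁆
Move-⁅⁆ {i = suc i} {suc j} (s≤s h) = there (Move-⁅⁆ h)

-- The point of `B` outside `A` is pushed into the block. In this way stability places the shadow of
-- `H` inside every link.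
Move-⋖ : {A B : Subset n} (i : Fin p) → A ⋖ B → Move (B ++ ∅) (A ++ ⁅ i ⁆)
Move-⋖ {A = _ ∷ A} i here      = here (++-⋖ A ∅⋖⁅ i ⁆)
Move-⋖             i (there c) = there (Move-⋖ i c)

∣∪∣+∣∩∣ : (A B : Subset n) → ∣ A ∪ B ∣ + ∣ A ∩ B ∣ ≡ ∣ A ∣ + ∣ B ∣
∣∪∣+∣∩∣ []          []          = refl
∣∪∣+∣∩∣ (true ∷ A)  (true ∷ B)  = cong suc (trans (+-suc _ _) (trans (cong suc (∣∪∣+∣∩∣ A B)) (sym (+-suc _ _))))
∣∪∣+∣∩∣ (true ∷ A)  (false ∷ B) = cong suc (∣∪∣+∣∩∣ A B)
∣∪∣+∣∩∣ (false ∷ A) (true ∷ B)  = trans (cong suc (∣∪∣+∣∩∣ A B)) (sym (+-suc _ _))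
∣∪∣+∣∩∣ (false ∷ A) (false ∷ B) = ∣∪∣+∣∩∣ A B

∣∪∣≤ : (A B : Subset n) → ∣ A ∪ B ∣ ≤ ∣ A ∣ + ∣ B ∣
∣∪∣≤ A B = ≤-trans (m≤m+n _ ∣ A ∩ B ∣) (≤-reflexive (∣∪∣+∣∩∣ A B))

grow : (A U : Subset n) → Disj A U → ∣ A ∣ + ∣ U ∣ < n → ∃[ B ] (A ⋖ B × Disj B U)
grow (false ∷ A) (false ∷ U) d lt = true ∷ A , here , d
grow (true ∷ A)  (false ∷ U) d lt with grow A U d (≤-pred lt)
... | B , c , e = true ∷ B , there c , e
grow {suc n} (false ∷ A) (true ∷ U) d lt
  with grow A U d (≤-pred (subst (_< suc n) (+-suc ∣ A ∣ ∣ U ∣) lt))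
... | B , c , e = false ∷ B , there c , e

Disj-⋃⁺ : (A : Subset n) (L : List (Subset n)) → All (Disj A) L → Disj A (⋃ L)
Disj-⋃⁺ A []      []       = Disj-sym {A = ∅} {A} (Disj-∅ A)
Disj-⋃⁺ A (B ∷ L) (d ∷ ds) = Disj-sym {A = B ∪ ⋃ L}
  (Disj-∪⁺ B (⋃ L) A (Disj-sym {A = A} d) (Disj-sym {A = A} (Disj-⋃⁺ A L ds)))

Disj-∪ʳ⁻ : (A B E : Subset n) → Disj A (B ∪ E) → Disj A B × Disj A E
Disj-∪ʳ⁻ A B E d with Disj-∪⁻ B E A (Disj-sym {A = A} d)
... | x , y = Disj-sym {A = B} x , Disj-sym {A = E} y

Disj-∪ʳ⁺ : (A B E : Subset n) → Disj A B → Disj A E → Disj A (B ∪ E)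
Disj-∪ʳ⁺ A B E d e = Disj-sym {A = B ∪ E} (Disj-∪⁺ B E A (Disj-sym {A = A} d) (Disj-sym {A = A} e))

Disj-⋃⁻ : (A : Subset n) (L : List (Subset n)) → Disj A (⋃ L) → All (Disj A) L
Disj-⋃⁻ A []      d = []
Disj-⋃⁻ A (B ∷ L) d with Disj-∪ʳ⁻ A B (⋃ L) d
... | x , y = x ∷ Disj-⋃⁻ A L y

∣⋃∣≤ : ∀ l (L : List (Subset n)) → All (λ A → ∣ A ∣ ≡ l) L → ∣ ⋃ L ∣ ≤ length L * l
∣⋃∣≤ {n} l []      []       = ≤-reflexive (∣⊥∣≡0 n)
∣⋃∣≤     l (A ∷ L) (e ∷ es) =
  ≤-trans (∣∪∣≤ A (⋃ L)) (+-mono-≤ (≤-reflexive e) (∣⋃∣≤ l L es))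

-- Each new point avoids the finished sets, collected in `W`, as well as those still to be enlarged.
-- `P` and `Q` differ because enlarging turns a member of a link into a member of another
-- restriction.
grow-all : ∀ l {P Q : Subset n → Set} → (∀ {A B} → A ⋖ B → P A → Q B) →
  (L : List (Subset n)) (W : Subset n) → AllPairs Disj L → All (Disj W) L → All P L →
  All (λ A → ∣ A ∣ ≡ l) L → ∣ W ∣ + length L * suc l ≤ n →
  ∃[ L′ ] (length L′ ≡ length L × AllPairs Disj L′ × All (Disj W) L′ × All Q L′)
grow-all l step [] W _ _ _ _ _ = [] , refl , [] , [] , []
grow-all {n} l step (A ∷ L) W (dA ∷ dL) (wA ∷ wL) (pA ∷ pL) (eA ∷ eL) le
  with grow A (W ∪ ⋃ L) (Disj-∪ʳ⁺ A W (⋃ L) (Disj-sym {A = W} wA) (Disj-⋃⁺ A L dA)) room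
  where
  open ≤-Reasoning
  regroup : ∀ w x l → suc (l + (w + x * l)) + x ≡ w + (suc l + x * suc l)
  regroup = solve-∀
  room : ∣ A ∣ + ∣ W ∪ ⋃ L ∣ < n
  room = begin-strict
    ∣ A ∣ + ∣ W ∪ ⋃ L ∣                  ≤⟨ +-mono-≤ (≤-reflexive eA) (≤-trans (∣∪∣≤ W (⋃ L)) (+-monoʳ-≤ ∣ W ∣ (∣⋃∣≤ l L eL))) ⟩
    l + (∣ W ∣ + length L * l)           <⟨ m≤m+n _ (length L) ⟩
    suc (l + (∣ W ∣ + length L * l)) + length L ≡⟨ regroup ∣ W ∣ (length L) l ⟩
    ∣ W ∣ + (suc l + length L * suc l)   ≤⟨ le ⟩
    n                                    ∎
... | B , A⋖B , dB with Disj-∪ʳ⁻ B W (⋃ L) dB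
... | BW , BL with grow-all l step L (W ∪ B) dL
       (All.zipWith (λ { {X} (x , y) → Disj-∪⁺ W B X x y }) (wL , Disj-⋃⁻ B L BL)) pL eL
       (≤-trans (+-monoˡ-≤ _ (∣∪∣≤ W B)) (≤-trans (≤-reflexive
         (trans (cong (λ z → ∣ W ∣ + z + length L * suc l) (trans (⋖-size A⋖B) (cong suc eA)))
                (+-assoc ∣ W ∣ (suc l) (length L * suc l)))) le))
...   | L′ , len , dL′ , wL′ , qL′ =
  B ∷ L′ , cong suc len , All.map (λ {X} → proj₂ ∘ Disj-∪⁻ W B X) wL′ ∷ dL′
  , Disj-sym {A = B} BW ∷ All.map (λ {X} → proj₁ ∘ Disj-∪⁻ W B X) wL′ , step A⋖B pA ∷ qL′

∌∅ : (F : Family n) → Matching≤ s F → ¬ (F ∋ ∅)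
∌∅ {n} {s} F ν F∅ = n≮n s (subst (_≤ s) (length-tabulate {n = suc s} (λ _ → ∅))
  (ν (List.tabulate {n = suc s} (λ _ → ∅)) (All.tabulate⁺ (λ _ → F∅))
    (AllPairs.tabulate⁺ {f = λ _ → ∅} (λ _ → Disj-∅ (∅ {n})))))

∣∣≡0 : (A : Subset n) → ∣ A ∣ ≡ 0 → A ≡ ∅
∣∣≡0 []          e = refl
∣∣≡0 (false ∷ A) e = cong (false ∷_) (∣∣≡0 A e)

Matching≤-true : ∀ l (F : Family (suc n)) → suc s * suc l ≤ n → Uniform (suc l) F → Stable F →
  Matching≤ s F → Matching≤ s (F ∘ (true ∷_))
Matching≤-true {n} {s} l F le unif stab ν L FL dL with length L ≤? s
... | yes q = q
... | no  q = contradiction (subst (_≤ s) long (ν _ (All.map⁺ (proj₂ (proj₂ (proj₂ (proj₂ grown)))))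
      (AllPairs.map⁺ (proj₁ (proj₂ (proj₂ grown)))))) (n≮n s)
  where
  -- The list is cut to length `suc s`, as the ground set is only known to have room for that many
  -- enlarged sets.
  L₀ = List.take (suc s) L
  FL₀ : All (λ A → F ∋ (true ∷ A)) L₀
  FL₀ = All.take⁺ (suc s) FL
  len₀ : length L₀ ≡ suc s
  len₀ = trans (length-take (suc s) L) (m≤n⇒m⊓n≡m (≰⇒> q))
  grown = grow-all l {λ A → F ∋ (true ∷ A)} {λ B → F ∋ (false ∷ B)} (λ c → stab (here c)) L₀ ∅
    (AllPairs.take⁺ (suc s) dL) (All.tabulate (λ {X} _ → Disj-∅ X)) FL₀
    (All.map (λ {A} FA → suc-injective (unif (true ∷ A) FA)) FL₀)
    (subst₂ (λ x y → x + y * suc l ≤ n) (sym (∣⊥∣≡0 n)) (sym len₀) le)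
  long : length (map (false ∷_) (proj₁ grown)) ≡ suc s
  long = trans (length-map (false ∷_) (proj₁ grown)) (trans (proj₁ (proj₂ grown)) len₀)

-- Counts the pairs `A ⋖ B` with `B` in `H`: each `B` covers `∣ B ∣` sets, all in `D`, and each `A`
-- is covered by `∣ ∁ A ∣` sets.
double-count : (H D : Family n) → (∀ {A B} → A ⋖ B → H ∋ B → D ∋ A) →
  (∑ λ B → 𝟙 (H B) * ∣ B ∣) ≤ (∑ λ A → 𝟙 (D A) * ∣ ∁ A ∣)
double-count {zero}  H D cl rewrite *-zeroʳ (𝟙 (H [])) = z≤n
double-count {suc n} H D cl = begin
  (∑ λ B → 𝟙 (H₁ B) * suc ∣ B ∣) + (∑ λ B → 𝟙 (H₀ B) * ∣ B ∣)
    ≡⟨ cong (_+ (∑ λ B → 𝟙 (H₀ B) * ∣ B ∣)) (trans (∑-cong (λ B → *-suc (𝟙 (H₁ B)) ∣ B ∣)) (∑-+ (𝟙 ∘ H₁) _)) ⟩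
  size H₁ + (∑ λ B → 𝟙 (H₁ B) * ∣ B ∣) + (∑ λ B → 𝟙 (H₀ B) * ∣ B ∣)
    -- Pairs that differ in the first coordinate give `size H₁ ≤ size D₀`; all others are handled by
    -- induction.
    ≤⟨ +-mono-≤ (+-mono-≤ (∑-mono (λ A → 𝟙-mono (cl (here {A = A}))))
         (double-count H₁ D₁ (λ c → cl (there c)))) (double-count H₀ D₀ (λ c → cl (there c))) ⟩
  size D₀ + (∑ λ A → 𝟙 (D₁ A) * ∣ ∁ A ∣) + (∑ λ A → 𝟙 (D₀ A) * ∣ ∁ A ∣)
    ≡⟨ rotate (size D₀) _ _ ⟩
  (∑ λ A → 𝟙 (D₁ A) * ∣ ∁ A ∣) + (size D₀ + (∑ λ A → 𝟙 (D₀ A) * ∣ ∁ A ∣))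
    ≡⟨ cong ((∑ λ A → 𝟙 (D₁ A) * ∣ ∁ A ∣) +_) (trans (∑-cong (λ A → *-suc (𝟙 (D₀ A)) ∣ ∁ A ∣)) (∑-+ (𝟙 ∘ D₀) _)) ⟨
  (∑ λ A → 𝟙 (D₁ A) * ∣ ∁ A ∣) + (∑ λ A → 𝟙 (D₀ A) * suc ∣ ∁ A ∣) ∎
  where
  open ≤-Reasoning
  H₁ = H ∘ (true ∷_)
  H₀ = H ∘ (false ∷_)
  D₁ = D ∘ (true ∷_)
  D₀ = D ∘ (false ∷_)
  rotate : ∀ a b c → a + b + c ≡ b + (a + c)
  rotate = solve-∀

size-all-false : (F : Family n) → (∀ A → F A ≡ false) → size F ≡ 0
size-all-false {n} F off = trans (∑-cong (λ A → cong 𝟙 (off A))) (size-empty n)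

Bool-¬true : ∀ {b} → ¬ (b ≡ true) → b ≡ false
Bool-¬true {true}  f = contradiction refl f
Bool-¬true {false} f = refl

∑-uniform : (F : Family n) (g : Subset n → ℕ) (c : ℕ) → (∀ A → F ∋ A → g A ≡ c) →
  (∑ λ A → 𝟙 (F A) * g A) ≡ c * size F
∑-uniform F g c e = trans (∑-cong (λ A → 𝟙*-cong (F A) (e A)))
  (trans (∑-*ʳ (𝟙 ∘ F) c) (*-comm (size F) c))

-- Induction on the points outside the block. While at least `suc s * k` points remain besides the
-- first, the members missing the first point and the link of that point both inherit the
-- hypotheses, and the two inequalities add up. On smaller ground sets double counting suffices. `D`
-- is any family containing the shadow, so that it can be restricted along with `F`. The condition
-- `2 ≤ p` makes the inequality strict, which the equality case relies on.
shadow : ∀ n {p} k s (F : Family (n + p)) (D : Family n) → 2 ≤ p →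
  Uniform k F → Stable F → Matching≤ s F →
  (∀ {A B} → A ⋖ B → F ∋ (B ++ ∅) → D ∋ A) → (∀ A → D ∋ A → suc ∣ A ∣ ≡ k) →
  size {n} (λ u → F (u ++ ∅)) < s * size D ⊎ size {n} (λ u → F (u ++ ∅)) ≡ 0
shadow n zero s F D _ unif stab ν cl Du = inj₂ (size-all-false {n} _ λ u → Bool-¬true λ Fu →
  ∌∅ F ν (subst (F ∋_) (∣∣≡0 _ (unif _ Fu)) Fu))
shadow zero {p} (suc l) s F D _ unif stab ν cl Du = inj₂ (cong 𝟙 (Bool-¬true (∌∅ F ν)))
shadow (suc n) {p} (suc l) s F D p≥2 unif stab ν cl Du with suc s * suc l ≤? n + p
... | yes le with shadow n (suc l) s (F ∘ (false ∷_)) (D ∘ (false ∷_)) p≥2 (λ A → unif (false ∷ A))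
                   (λ m → stab (there m)) (λ L FL dL → subst (_≤ s) (length-map (false ∷_) L)
                     (ν _ (All.map⁺ FL) (AllPairs.map⁺ dL)))
                   (λ c → cl (there c)) (λ A → Du (false ∷ A))
               | shadow n l s (F ∘ (true ∷_)) (D ∘ (true ∷_)) p≥2
                   (λ A FA → suc-injective (unif (true ∷ A) FA))
                   (λ m → stab (there m)) (Matching≤-true l F le unif stab ν)
                   (λ c → cl (there c)) (λ A DA → suc-injective (Du (true ∷ A) DA))
...   | inj₁ x | inj₁ y = inj₁ (≤-trans (+-mono-<-≤ y (<⇒≤ x)) (≤-reflexive (sym (*-distribˡ-+ s _ _))))
...   | inj₁ x | inj₂ y = inj₁ (≤-trans (+-mono-≤-< (≤-trans (≤-reflexive y) z≤n) x)
                                        (≤-reflexive (sym (*-distribˡ-+ s (size (D ∘ (true ∷_))) _))))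
...   | inj₂ x | inj₁ y = inj₁ (≤-trans (+-mono-<-≤ y (≤-trans (≤-reflexive x) z≤n))
                                        (≤-reflexive (sym (*-distribˡ-+ s _ (size (D ∘ (false ∷_)))))))
...   | inj₂ x | inj₂ y = inj₂ (cong₂ _+_ y x)
-- Members of `H` have `suc l` lower covers and sets in `D` have `e = suc n ∸ l` upper covers. The
-- failed room condition together with `p≥2` yields `e + suc l = n + 2 ≤ n + p < suc s * suc l`.
shadow (suc n) {p} (suc l) s F D p≥2 unif stab ν cl Du | no nle with size {suc n} (λ u → F (u ++ ∅)) in eq
... | zero  = inj₂ refl
... | suc h = inj₁ (*-cancelˡ-< (suc l) (suc h) (s * size D) (begin-strict
  suc l * suc h        ≤⟨ count ⟩
  e * size D           <⟨ *-monoˡ-< (size D) {{D≢0}} e<sk ⟩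
  (s * suc l) * size D ≡⟨ regroup s (suc l) (size D) ⟩
  suc l * (s * size D) ∎))
  where
  open ≤-Reasoning
  e = suc n ∸ l
  regroup : ∀ a b c → (a * b) * c ≡ b * (a * c)
  regroup = solve-∀
  H : Family (suc n)
  H u = F (u ++ ∅)
  H-size : ∀ u → H ∋ u → ∣ u ∣ ≡ suc l
  H-size u Hu = trans (sym (trans (∣++∣ u (∅ {p})) (trans (cong (∣ u ∣ +_) (∣⊥∣≡0 p)) (+-identityʳ _)))) (unif _ Hu)
  count : suc l * suc h ≤ e * size D
  count = begin
    suc l * suc h  ≡⟨ cong (suc l *_) eq ⟨
    suc l * size H ≡⟨ ∑-uniform H ∣_∣ (suc l) H-size ⟨
    (∑ λ B → 𝟙 (H B) * ∣ B ∣) ≤⟨ double-count H D cl ⟩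
    (∑ λ A → 𝟙 (D A) * ∣ ∁ A ∣)
      ≡⟨ ∑-uniform D (λ A → ∣ ∁ A ∣) e (λ A DA → trans (∣∁p∣≡n∸∣p∣ A) (cong (suc n ∸_) (suc-injective (Du A DA)))) ⟩
    e * size D ∎
  D≢0 : NonZero (size D)
  D≢0 = ≢-nonZero λ z → n≮0 (≤-trans count (≤-reflexive (trans (cong (e *_) z) (*-zeroʳ e))))
  -- Ensures that the subtraction defining `e` is not truncated.
  e≢0 : e ≢ 0
  e≢0 z = n≮0 (≤-trans count (≤-reflexive (cong (_* size D) z)))
  e<sk : e < s * suc l
  e<sk = +-cancelʳ-≤ (suc l) _ _ (begin
    suc e + suc l      ≡⟨ cong suc (+-suc e l) ⟩
    2 + (e + l)        ≡⟨ cong (2 +_) (m∸n+n≡m {suc n} {l} (<⇒≤ (m∸n≢0⇒n<m {suc n} {l} e≢0))) ⟩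
    2 + suc n          ≤⟨ +-monoˡ-≤ (suc n) p≥2 ⟩
    p + suc n          ≡⟨ +-comm p (suc n) ⟩
    suc (n + p)        ≤⟨ ≰⇒> nle ⟩
    suc s * suc l      ≡⟨ +-comm (suc l) _ ⟩
    s * suc l + suc l  ∎)

-- The bound for stable families

∑-split₁ : (g : Subset n → ℕ) → ∑ g ≡ g ∅ + (∑ λ v → 𝟙 (1 ≤ᵇ ∣ v ∣) * g v)
∑-split₁ {zero}  g = sym (+-identityʳ _)
∑-split₁ {suc n} g = begin
  ∑ (g ∘ (true ∷_)) + ∑ (g ∘ (false ∷_))
    ≡⟨ cong₂ _+_ (∑-cong (λ v → sym (*-identityˡ (g (true ∷ v))))) (∑-split₁ (g ∘ (false ∷_))) ⟩
  (∑ λ v → 1 * g (true ∷ v)) + (g ∅ + (∑ λ v → 𝟙 (1 ≤ᵇ ∣ v ∣) * g (false ∷ v)))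
    ≡⟨ rotate (∑ λ v → 1 * g (true ∷ v)) (g ∅) _ ⟩
  g ∅ + ((∑ λ v → 1 * g (true ∷ v)) + (∑ λ v → 𝟙 (1 ≤ᵇ ∣ v ∣) * g (false ∷ v))) ∎
  where
  open ≡-Reasoning
  rotate : ∀ a b c → a + (b + c) ≡ b + (a + c)
  rotate = solve-∀

-- Applied to the trace of a set on the block; the three terms lead to `H`, to the links and to the
-- remaining members.
∑-split₂ : (g : Subset n → ℕ) →
  ∑ g ≡ g ∅ + ∑ᶠ (λ i → g ⁅ i ⁆) + (∑ λ v → 𝟙 (2 ≤ᵇ ∣ v ∣) * g v)
∑-split₂ {zero}  g = sym (trans (+-identityʳ _) (+-identityʳ _))
∑-split₂ {suc n} g = trans
  (cong₂ _+_ (∑-split₁ (g ∘ (true ∷_))) (∑-split₂ (g ∘ (false ∷_))))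
  (regroup (g ⁅ zero ⁆) (∑ λ v → 𝟙 (1 ≤ᵇ ∣ v ∣) * g (true ∷ v)) (g ∅) (∑ᶠ (λ i → g ⁅ suc i ⁆)) _)
  where
  regroup : ∀ a b c d e → (a + b) + (c + d + e) ≡ c + (a + d) + (b + e)
  regroup = solve-∀

disj-++ : (A B : Subset n) (X Y : Subset p) → disj (A ++ X) (B ++ Y) ≡ disj A B ∧ disj X Y
disj-++ []      []      X Y = refl
disj-++ (a ∷ A) (b ∷ B) X Y =
  trans (cong (not (a ∧ b) ∧_) (disj-++ A B X Y)) (sym (Bool.∧-assoc (not (a ∧ b)) _ _))

Disj-⊤⁻ : (v : Subset n) → Disj ⊤ v → v ≡ ∅
Disj-⊤⁻ []          d = refl
Disj-⊤⁻ (false ∷ v) d = cong (false ∷_) (Disj-⊤⁻ v d)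

-- The block without its first point. Moves go towards the end, so the link at the first point is
-- the smallest one, and it is empty in the extremal family.
tail-set : ∀ n s → Subset (n + suc s)
tail-set n s = ∅ {n} ++ (false ∷ ⊤ {s})

∣tail-set∣ : ∀ n s → ∣ tail-set n s ∣ ≡ s
∣tail-set∣ n s = trans (∣++∣ (∅ {n}) (false ∷ ⊤ {s})) (cong₂ _+_ (∣⊥∣≡0 n) (∣⊤∣≡n s))

disj-tail-set : (u : Subset n) (b : Bool) (v : Subset s) → disj (tail-set n s) (u ++ (b ∷ v)) ≡ disj ⊤ v
disj-tail-set {n} {s} u b v = trans (disj-++ ∅ u (false ∷ ⊤) (b ∷ v)) (cong (_∧ disj ⊤ v) (Disj-∅ u))

∑ᶠ-const : ∀ s c → ∑ᶠ {s} (λ _ → c) ≡ s * c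
∑ᶠ-const zero    c = refl
∑ᶠ-const (suc s) c = cong (c +_) (∑ᶠ-const s c)

∑ᶠ-cong : {f g : Fin n → ℕ} → (∀ i → f i ≡ g i) → ∑ᶠ f ≡ ∑ᶠ g
∑ᶠ-cong {zero}  e = refl
∑ᶠ-cong {suc n} e = cong₂ _+_ (e zero) (∑ᶠ-cong (e ∘ suc))

meeting-intro : ∀ k (W B : Subset n) → ∣ B ∣ ≡ k → ¬ Disj W B → meeting k W ∋ B
meeting-intro k W B e nd = ∧-true⁺ (trans (cong (_≡ᵇ k) e) (≡ᵇ-refl k)) (cong not (Bool-¬true nd))

disjoint-singletons : (i j : Fin n) → i ≢ j → Disj ⁅ i ⁆ ⁅ j ⁆
disjoint-singletons zero    zero    ne = contradiction refl ne
disjoint-singletons zero    (suc j) ne = Disj-∅ ⁅ j ⁆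
disjoint-singletons (suc i) zero    ne = Disj-sym {A = ∅} {⁅ i ⁆} (Disj-∅ ⁅ i ⁆)
disjoint-singletons (suc i) (suc j) ne = disjoint-singletons i j (ne ∘ cong suc)

≤-or-> : (i j : Fin n) → i Fin.≤ j → i ≡ j ⊎ i Fin.< j
≤-or-> i j le with m≤n⇒m<n∨m≡n le
... | inj₁ lt = inj₂ lt
... | inj₂ e  = inj₁ (toℕ-injective e)

module _ {s l N : ℕ} (F : Family (N + suc s)) (s≥1 : 1 ≤ s) (room : (2 * s + 1) * l ≤ N)
         (unif : Uniform (suc l) F) (stab : Stable F) (ν : Matching≤ s F) where

  private
    M : Family (N + suc s)
    M = meeting (suc l) (tail-set N s)

    H : Family N
    H u = F (u ++ ∅)

    G : Fin (suc s) → Family N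
    G i u = F (u ++ ⁅ i ⁆)

    h g r r′ : ℕ
    h  = size H
    g  = ∑ {N} λ u → ∑ᶠ (λ i → 𝟙 (G i u))
    r  = ∑ {N} λ u → ∑ {suc s} λ v → 𝟙 (2 ≤ᵇ ∣ v ∣) * 𝟙 (F (u ++ v))
    r′ = ∑ {N} λ u → ∑ {suc s} λ v → 𝟙 (2 ≤ᵇ ∣ v ∣) * 𝟙 (M (u ++ v))

    size-F : size F ≡ h + g + r
    size-F = trans (∑-++ N (𝟙 ∘ F)) (trans (∑-cong {N} (λ u → ∑-split₂ (λ v → 𝟙 (F (u ++ v)))))
      (trans (∑-+ {N} (λ u → 𝟙 (H u) + ∑ᶠ (λ i → 𝟙 (G i u))) _)
        (cong (_+ r) (∑-+ (𝟙 ∘ H) (λ u → ∑ᶠ (λ i → 𝟙 (G i u)))))))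

    M-off : ∀ u b → M (u ++ (b ∷ ∅)) ≡ false
    M-off u b = trans (cong (λ d → ofSize (suc l) (u ++ (b ∷ ∅)) ∧ not d)
        (trans (disj-tail-set u b ∅) (Disj-sym {A = ∅ {s}} {⊤ {s}} (Disj-∅ (⊤ {s})))))
      (Bool.∧-zeroʳ _)

    M-⁅suc⁆ : ∀ u i → M (u ++ ⁅ suc i ⁆) ≡ ofSize l u
    M-⁅suc⁆ u i = trans (cong₂ _∧_ (cong (_≡ᵇ suc l) (trans (∣++∣ u ⁅ suc i ⁆)
        (trans (cong (∣ u ∣ +_) (∣⁅x⁆∣≡1 i)) (+-comm ∣ u ∣ 1))))
        (cong not (trans (disj-tail-set u false ⁅ i ⁆) (meets i))))
      (Bool.∧-identityʳ _)
      where
      meets : ∀ {n} (i : Fin n) → disj ⊤ ⁅ i ⁆ ≡ false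
      meets zero    = refl
      meets (suc i) = meets i

    size-M : size M ≡ s * (N C l) + r′
    size-M = trans (∑-++ N (𝟙 ∘ M)) (trans (∑-cong {N} (λ u → ∑-split₂ (λ v → 𝟙 (M (u ++ v)))))
      (trans (∑-+ {N} (λ u → 𝟙 (M (u ++ ∅)) + ∑ᶠ (λ i → 𝟙 (M (u ++ ⁅ i ⁆)))) _)
        (cong (_+ r′) (trans (∑-cong small) (trans (∑-*ˡ {N} s (𝟙 ∘ ofSize l))
          (cong (s *_) (size-ofSize N l)))))))
      where
      small : ∀ u → 𝟙 (M (u ++ ∅)) + ∑ᶠ (λ i → 𝟙 (M (u ++ ⁅ i ⁆))) ≡ s * 𝟙 (ofSize l u)
      small u = trans (cong₂ (λ a b → 𝟙 a + (𝟙 b + ∑ᶠ (λ i → 𝟙 (M (u ++ ⁅ suc i ⁆))))) (M-off u false) (M-off u true))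
        (trans (∑ᶠ-cong (λ i → cong 𝟙 (M-⁅suc⁆ u i))) (∑ᶠ-const s _))

    F⇒M : ∀ u b v → F ∋ (u ++ (b ∷ v)) → v ≢ ∅ → M ∋ (u ++ (b ∷ v))
    F⇒M u b v FA ne = meeting-intro (suc l) (tail-set N s) _ (unif _ FA)
      (λ d → ne (Disj-⊤⁻ v (trans (sym (disj-tail-set u b v)) d)))

    -- Of two points in the block at least one is not the first, hence lies in `tail-set N s`.
    r≤r′ : r ≤ r′
    r≤r′ = ∑-mono {N} λ u → ∑-mono {suc s} λ v → 𝟙*-mono (2 ≤ᵇ ∣ v ∣) λ big → 𝟙-mono (λ FA → lift u v FA big)
      where
      lift : ∀ u v → F ∋ (u ++ v) → (2 ≤ᵇ ∣ v ∣) ≡ true → M ∋ (u ++ v)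
      lift u (b ∷ v) FA big = F⇒M u b v FA λ e → small b (subst (λ v → (2 ≤ᵇ ∣ b ∷ v ∣) ≡ true) e big)
        where
        small : ∀ b → (2 ≤ᵇ ∣ b ∷ ∅ {s} ∣) ≢ true
        small true  rewrite ∣⊥∣≡0 s = λ ()
        small false rewrite ∣⊥∣≡0 s = λ ()

    G-size : ∀ i → Uniform l (G i)
    G-size i u Gu = suc-injective (trans (sym (trans (∣++∣ u ⁅ i ⁆)
      (trans (cong (∣ u ∣ +_) (∣⁅x⁆∣≡1 i)) (+-comm ∣ u ∣ 1)))) (unif _ Gu))

    G-mono : ∀ i j → i Fin.≤ j → ∀ u → G i ∋ u → G j ∋ u
    G-mono i j le u Gu with ≤-or-> i j le
    ... | inj₁ refl = Gu
    ... | inj₂ lt   = stab (++-Move u (Move-⁅⁆ lt)) Gu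

    no-transversal : ¬ Transversal G
    no-transversal (u , Gu , du) = n≮n s (subst (_≤ s) (length-tabulate A)
      (ν (List.tabulate A) (All.tabulate⁺ Gu) (AllPairs.tabulate⁺ {f = A} λ {i} {j} ne →
        Disj-++⁺ {A = u i} {u j} (du i j ne) (disjoint-singletons i j ne))))
      where
      A : Fin (suc s) → Subset (N + suc s)
      A i = u i ++ ⁅ i ⁆

    weighted : s * size (G zero) + g ≤ s * (N C l)
    weighted = ≤-trans (≤-reflexive (sym (trans (∑-+ (λ u → s * 𝟙 (G zero u)) _)
        (cong (_+ g) (∑-*ˡ s (𝟙 ∘ G zero))))))
      (cross-dependent G G-mono l room G-size no-transversal)

    H-shadow : h < s * size (G zero) ⊎ h ≡ 0
    H-shadow = shadow N (suc l) s F (G zero) (s≤s s≥1) unif stab ν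
      (λ c → stab (Move-⋖ zero c)) (λ u Gu → cong suc (G-size zero u Gu))

    h≤ : h ≤ s * size (G zero)
    h≤ with H-shadow
    ... | inj₁ lt = <⇒≤ lt
    ... | inj₂ e  = ≤-trans (≤-reflexive e) z≤n

  stable-bound : size F ≤ size M
  stable-bound = begin
    size F                        ≡⟨ size-F ⟩
    h + g + r                     ≤⟨ +-mono-≤ (+-monoˡ-≤ g h≤) r≤r′ ⟩
    s * size (G zero) + g + r′    ≤⟨ +-monoˡ-≤ r′ weighted ⟩
    s * (N C l) + r′              ≡⟨ size-M ⟨
    size M                        ∎
    where open ≤-Reasoning

  -- Equality leaves `s * size (G zero) ≤ h`, against the strict alternative of `H-shadow`. So `h`
  -- vanishes, and `size (G zero)` with it because `s ≥ 1`. Then `F` is contained in `M`, and the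
  -- sizes agree.
  stable-equality : size F ≡ size M → ∀ A → F A ≡ M A
  stable-equality eq = λ A → 𝟙-injective (∑-≤-≡ (λ A → 𝟙-mono (F⊆M A)) eq A)
    where
    open ≤-Reasoning
    squeeze : s * size (G zero) + g ≤ h + g
    squeeze = +-cancelʳ-≤ r′ _ _ (begin
      s * size (G zero) + g + r′ ≤⟨ +-monoˡ-≤ r′ weighted ⟩
      s * (N C l) + r′           ≡⟨ trans (sym size-M) (trans (sym eq) size-F) ⟩
      h + g + r                  ≤⟨ +-monoʳ-≤ (h + g) r≤r′ ⟩
      h + g + r′                 ∎)
    sG≤h : s * size (G zero) ≤ h
    sG≤h = +-cancelʳ-≤ g _ _ squeeze
    h≡0 : h ≡ 0
    h≡0 with H-shadow
    ... | inj₁ lt = contradiction sG≤h (<⇒≱ lt)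
    ... | inj₂ e  = e
    G₀≡0 : size (G zero) ≡ 0
    G₀≡0 with m*n≡0⇒m≡0∨n≡0 s (n≤0⇒n≡0 (≤-trans sG≤h (≤-reflexive h≡0)))
    ... | inj₁ s≡0 = contradiction s≥1 (<⇒≱ (s≤s (≤-reflexive s≡0)))
    ... | inj₂ e   = e
    F⊆M : ∀ A → F ∋ A → M ∋ A
    F⊆M A FA with splitAt N A
    F⊆M _ FA | u , b ∷ v , refl = F⇒M u b v FA λ { refl → absurd b FA }
      where
      absurd : ∀ b → ¬ (F ∋ (u ++ (b ∷ ∅)))
      absurd true  FA with trans (sym FA) (size≡0⇒∌ (G zero) G₀≡0 u)
      ... | ()
      absurd false FA with trans (sym FA) (size≡0⇒∌ H h≡0 u)
      ... | ()

-- Shifting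

-- Position of a set relative to the adjacent pair i, i + 1: it contains only i (source),
-- only i + 1 (target), or neither distinguishes them (neutral).
data Kind : Set where
  source target neutral : Kind

kind : Fin n → Subset n → Kind
kind zero    (true ∷ false ∷ A) = source
kind zero    (false ∷ true ∷ A) = target
kind zero    (true ∷ true ∷ A)  = neutral
kind zero    (false ∷ false ∷ A) = neutral
kind zero    (a ∷ [])           = neutral
kind (suc i) (a ∷ A)            = kind i A

τ : Fin n → Subset n → Subset n
τ zero    (a ∷ b ∷ A) = b ∷ a ∷ A
τ zero    (a ∷ [])    = a ∷ []
τ (suc i) (a ∷ A)     = a ∷ τ i A

reverse : Kind → Kind
reverse source  = target
reverse target  = source
reverse neutral = neutral

kind-τ : ∀ i (A : Subset n) → kind i (τ i A) ≡ reverse (kind i A)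
kind-τ zero    (true ∷ true ∷ A)   = refl
kind-τ zero    (true ∷ false ∷ A)  = refl
kind-τ zero    (false ∷ true ∷ A)  = refl
kind-τ zero    (false ∷ false ∷ A) = refl
kind-τ zero    (true ∷ [])         = refl
kind-τ zero    (false ∷ [])        = refl
kind-τ (suc i) (a ∷ A)             = kind-τ i A

τ-involutive : ∀ i (A : Subset n) → τ i (τ i A) ≡ A
τ-involutive zero    (a ∷ b ∷ A) = refl
τ-involutive zero    (a ∷ [])    = refl
τ-involutive (suc i) (a ∷ A)     = cong (a ∷_) (τ-involutive i A)

τ-neutral : ∀ i (A : Subset n) → kind i A ≡ neutral → τ i A ≡ A
τ-neutral zero    (true ∷ true ∷ A)   e = refl
τ-neutral zero    (false ∷ false ∷ A) e = refl
τ-neutral zero    (a ∷ [])            e = refl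
τ-neutral (suc i) (a ∷ A)             e = cong (a ∷_) (τ-neutral i A e)

∣τ∣ : ∀ i (A : Subset n) → ∣ τ i A ∣ ≡ ∣ A ∣
∣τ∣ zero    (true ∷ true ∷ A)   = refl
∣τ∣ zero    (true ∷ false ∷ A)  = refl
∣τ∣ zero    (false ∷ true ∷ A)  = refl
∣τ∣ zero    (false ∷ false ∷ A) = refl
∣τ∣ zero    (a ∷ [])            = refl
∣τ∣ (suc i) (true ∷ A)          = cong suc (∣τ∣ i A)
∣τ∣ (suc i) (false ∷ A)         = ∣τ∣ i A

disj-τ : ∀ i (A B : Subset n) → disj (τ i A) (τ i B) ≡ disj A B
disj-τ zero    (a ∷ a′ ∷ A) (b ∷ b′ ∷ B) = begin
  not (a′ ∧ b′) ∧ (not (a ∧ b) ∧ disj A B) ≡⟨ Bool.∧-assoc (not (a′ ∧ b′)) _ _ ⟨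
  (not (a′ ∧ b′) ∧ not (a ∧ b)) ∧ disj A B ≡⟨ cong (_∧ disj A B) (Bool.∧-comm (not (a′ ∧ b′)) _) ⟩
  (not (a ∧ b) ∧ not (a′ ∧ b′)) ∧ disj A B ≡⟨ Bool.∧-assoc (not (a ∧ b)) _ _ ⟩
  not (a ∧ b) ∧ (not (a′ ∧ b′) ∧ disj A B) ∎
  where open ≡-Reasoning
disj-τ zero    (a ∷ [])     (b ∷ [])     = refl
disj-τ (suc i) (a ∷ A)      (b ∷ B)      = cong (not (a ∧ b) ∧_) (disj-τ i A B)

disj-τˡ : ∀ i (A B : Subset n) → disj (τ i A) B ≡ disj A (τ i B)
disj-τˡ i A B = trans (cong (disj (τ i A)) (sym (τ-involutive i B))) (disj-τ i A (τ i B))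

∑-τ : ∀ i (f : Subset n → ℕ) → ∑ (f ∘ τ i) ≡ ∑ f
∑-τ {suc (suc n)} zero f = interchange (∑ {n} λ A → f (true ∷ true ∷ A)) _ _ _
∑-τ {suc zero}    zero f = refl
∑-τ (suc i) f = cong₂ _+_ (∑-τ i (f ∘ (true ∷_))) (∑-τ i (f ∘ (false ∷_)))

∑-double : ∀ i (f : Subset n → ℕ) → (∑ λ A → f A + f (τ i A)) ≡ 2 * ∑ f
∑-double i f = trans (∑-+ f (f ∘ τ i)) (cong (∑ f +_) (trans (∑-τ i f) (sym (+-identityʳ _))))

-- As `τ i` permutes the subsets, summing over pairs counts everything twice.
∑-pairs-≤ : ∀ i {f g : Subset n → ℕ} → (∀ A → f A + f (τ i A) ≤ g A + g (τ i A)) → ∑ f ≤ ∑ g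
∑-pairs-≤ i {f} {g} le = *-cancelˡ-≤ 2 (subst₂ _≤_ (∑-double i f) (∑-double i g) (∑-mono le))

∑-pairs-< : ∀ i {f g : Subset n → ℕ} → (∀ A → f A + f (τ i A) ≤ g A + g (τ i A)) →
  ∀ A → f A + f (τ i A) < g A + g (τ i A) → ∑ f < ∑ g
∑-pairs-< i {f} {g} le A lt =
  *-cancelˡ-< 2 _ _ (subst₂ _<_ (∑-double i f) (∑-double i g) (∑-mono-< le A lt))

-- Acts on each pair `A`, `τ i A` separately: if exactly one of source and target is present, the
-- target is kept. Only adjacent positions are exchanged; `Stable-adjacent` shows that these shifts
-- suffice.
shift : Fin n → Family n → Family n
shift i F A with kind i A
... | source  = F A ∧ F (τ i A)
... | target  = F A ∨ F (τ i A)
... | neutral = F A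

shift-source : ∀ i (F : Family n) A → kind i A ≡ source → shift i F A ≡ F A ∧ F (τ i A)
shift-source i F A e rewrite e = refl

shift-target : ∀ i (F : Family n) A → kind i A ≡ target → shift i F A ≡ F A ∨ F (τ i A)
shift-target i F A e rewrite e = refl

shift-neutral : ∀ i (F : Family n) A → kind i A ≡ neutral → shift i F A ≡ F A
shift-neutral i F A e rewrite e = refl

kind-τ-of : ∀ i (A : Subset n) {κ} → kind i A ≡ κ → kind i (τ i A) ≡ reverse κ
kind-τ-of i A e = trans (kind-τ i A) (cong reverse e)

shift-τ-source : ∀ i (F : Family n) A → kind i A ≡ source → shift i F (τ i A) ≡ F (τ i A) ∨ F A
shift-τ-source i F A e =
  trans (shift-target i F (τ i A) (kind-τ-of i A e)) (cong (λ B → F (τ i A) ∨ F B) (τ-involutive i A))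

shift-τ-target : ∀ i (F : Family n) A → kind i A ≡ target → shift i F (τ i A) ≡ F (τ i A) ∧ F A
shift-τ-target i F A e =
  trans (shift-source i F (τ i A) (kind-τ-of i A e)) (cong (λ B → F (τ i A) ∧ F B) (τ-involutive i A))

shift-τ-neutral : ∀ i (F : Family n) A → kind i A ≡ neutral → shift i F (τ i A) ≡ F (τ i A)
shift-τ-neutral i F A e = shift-neutral i F (τ i A) (kind-τ-of i A e)

size-shift : ∀ i (F : Family n) → size (shift i F) ≡ size F
size-shift i F = ≤-antisym (∑-pairs-≤ i (≤-reflexive ∘ pair)) (∑-pairs-≤ i (≤-reflexive ∘ sym ∘ pair))
  where
  ∧∨ : ∀ a b → 𝟙 (a ∧ b) + 𝟙 (b ∨ a) ≡ 𝟙 a + 𝟙 b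
  ∧∨ true  true  = refl
  ∧∨ true  false = refl
  ∧∨ false true  = refl
  ∧∨ false false = refl
  ∨∧ : ∀ a b → 𝟙 (a ∨ b) + 𝟙 (b ∧ a) ≡ 𝟙 a + 𝟙 b
  ∨∧ true  true  = refl
  ∨∧ true  false = refl
  ∨∧ false true  = refl
  ∨∧ false false = refl
  pair : ∀ A → 𝟙 (shift i F A) + 𝟙 (shift i F (τ i A)) ≡ 𝟙 (F A) + 𝟙 (F (τ i A))
  pair A with kind i A in eq
  ... | source  = trans (cong (λ b → 𝟙 (F A ∧ F (τ i A)) + 𝟙 b) (shift-τ-source i F A eq)) (∧∨ (F A) _)
  ... | target  = trans (cong (λ b → 𝟙 (F A ∨ F (τ i A)) + 𝟙 b) (shift-τ-target i F A eq)) (∨∧ (F A) _)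
  ... | neutral = cong (λ b → 𝟙 (F A) + 𝟙 b) (shift-τ-neutral i F A eq)

-- Each element counts the positions behind it, so a step towards the end lowers the sum by one.
-- Summed over a family this is the termination measure for shifting.
position-sum : Subset n → ℕ
position-sum                 []          = 0
position-sum {n = suc n} (true ∷ A)  = n + position-sum A
position-sum                 (false ∷ A) = position-sum A

position-sum-τ : ∀ i (A : Subset n) → kind i A ≡ source → position-sum A ≡ suc (position-sum (τ i A))
position-sum-τ zero    (true ∷ false ∷ A) e = refl
position-sum-τ zero    (true ∷ true ∷ A)   ()
position-sum-τ zero    (false ∷ true ∷ A)  ()
position-sum-τ zero    (false ∷ false ∷ A) ()
position-sum-τ {suc n} (suc i) (true ∷ A) e = trans (cong (n +_) (position-sum-τ i A e)) (+-suc n _)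
position-sum-τ (suc i) (false ∷ A)        e = position-sum-τ i A e

potential : Family n → ℕ
potential F = ∑ λ A → 𝟙 (F A) * position-sum A

potential-shift : ∀ i (F : Family n) A → kind i A ≡ source → F ∋ A → F (τ i A) ≡ false →
  potential (shift i F) < potential F
potential-shift i F A src FA FτA = ∑-pairs-< i pair A strict
  where
  w = position-sum
  ∧∨ : ∀ a b x → 𝟙 (a ∧ b) * suc x + 𝟙 (b ∨ a) * x ≤ 𝟙 a * suc x + 𝟙 b * x
  ∧∨ true  true  x = ≤-refl
  ∧∨ true  false x = ≤-trans (n≤1+n _) (≤-reflexive (cong suc (sym (+-identityʳ _))))
  ∧∨ false true  x = ≤-refl
  ∧∨ false false x = ≤-refl
  ∨∧ : ∀ a b x → 𝟙 (a ∨ b) * x + 𝟙 (b ∧ a) * suc x ≤ 𝟙 a * x + 𝟙 b * suc x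
  ∨∧ true  true  x = ≤-refl
  ∨∧ true  false x = ≤-refl
  ∨∧ false true  x = ≤-trans (≤-reflexive (+-identityʳ _)) (n≤1+n _)
  ∨∧ false false x = ≤-refl
  pair : ∀ A → 𝟙 (shift i F A) * w A + 𝟙 (shift i F (τ i A)) * w (τ i A)
    ≤ 𝟙 (F A) * w A + 𝟙 (F (τ i A)) * w (τ i A)
  pair A with kind i A in eq
  ... | source  rewrite shift-τ-source i F A eq | position-sum-τ i A eq = ∧∨ (F A) (F (τ i A)) _
  ... | target  rewrite shift-τ-target i F A eq
      | trans (position-sum-τ i (τ i A) (kind-τ-of i A eq)) (cong (suc ∘ w) (τ-involutive i A))
      = ∨∧ (F A) (F (τ i A)) _
  ... | neutral rewrite shift-τ-neutral i F A eq = ≤-refl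
  strict : 𝟙 (shift i F A) * w A + 𝟙 (shift i F (τ i A)) * w (τ i A)
    < 𝟙 (F A) * w A + 𝟙 (F (τ i A)) * w (τ i A)
  strict rewrite shift-τ-source i F A src | shift-source i F A src | position-sum-τ i A src | FA | FτA
    = ≤-reflexive (cong suc (sym (+-identityʳ _)))

-- A long move is a chain of adjacent ones. If the next place is free, the element steps there and
-- continues; if it is occupied, the occupant makes the rest of the move first and the element then
-- takes its place.
Stable-adjacent : (F : Family n) → (∀ i A → kind i A ≡ source → F ∋ A → F ∋ τ i A) → Stable F
Stable-adjacent F adj (here {A = false ∷ A} here) FA = adj zero (true ∷ false ∷ A) refl FA
Stable-adjacent F adj (here (there {b = false} {A} {B} c)) FA =
  Stable-adjacent (F ∘ (false ∷_)) (λ i A → adj (suc i) (false ∷ A)) (here c)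
    (adj zero (true ∷ false ∷ A) refl FA)
Stable-adjacent F adj (here (there {b = true} {A} {B} c)) FA =
  adj zero (true ∷ false ∷ B) refl
    (Stable-adjacent (F ∘ (true ∷_)) (λ i A → adj (suc i) (true ∷ A)) (here c) FA)
Stable-adjacent F adj (there {b = b} m) FA =
  Stable-adjacent (F ∘ (b ∷_)) (λ i A → adj (suc i) (b ∷ A)) m FA

targets-meet : ∀ i (A B : Subset n) → kind i A ≡ target → kind i B ≡ target → ¬ Disj A B
targets-meet zero    (false ∷ true ∷ A) (false ∷ true ∷ B) a b ()
targets-meet zero    (true ∷ true ∷ A)   _ ()
targets-meet zero    (true ∷ false ∷ A)  _ ()
targets-meet zero    (false ∷ false ∷ A) _ ()
targets-meet zero    (false ∷ true ∷ A)  (true ∷ true ∷ B)   _ ()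
targets-meet zero    (false ∷ true ∷ A)  (true ∷ false ∷ B)  _ ()
targets-meet zero    (false ∷ true ∷ A)  (false ∷ false ∷ B) _ ()
targets-meet (suc i) (x ∷ A) (y ∷ B) a b d = targets-meet i A B a b (proj₂ (∧-true⁻ {not (x ∧ y)} d))

sources-meet : ∀ i (A B : Subset n) → kind i A ≡ source → kind i B ≡ source → ¬ Disj A B
sources-meet i A B a b d =
  targets-meet i (τ i A) (τ i B) (kind-τ-of i A a) (kind-τ-of i B b) (trans (disj-τ i A B) d)

neutral-if-disjoint : ∀ i (A B E : Subset n) → kind i A ≡ target → kind i B ≡ source →
  Disj A E → Disj B E → kind i E ≡ neutral
neutral-if-disjoint i A B E a b dA dB with kind i E in eq
... | source  = contradiction dB (sources-meet i B E b eq)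
... | target  = contradiction dA (targets-meet i A E a eq)
... | neutral = refl

∨-true⁻ : ∀ {a b} → a ∨ b ≡ true → a ≡ true ⊎ b ≡ true
∨-true⁻ {true}  e = inj₁ refl
∨-true⁻ {false} e = inj₂ e

Uniform-shift : ∀ i (F : Family n) → Uniform k F → Uniform k (shift i F)
Uniform-shift i F unif A SA with kind i A
... | source  = unif A (proj₁ (∧-true⁻ SA))
... | neutral = unif A SA
... | target with ∨-true⁻ SA
...   | inj₁ FA = unif A FA
...   | inj₂ Fτ = trans (sym (∣τ∣ i A)) (unif (τ i A) Fτ)

all-or-counterexample : (F : Family n) (L : List (Subset n)) → All (F ∋_) L ⊎ ∃[ A ] (A ∈ᴸ L × F A ≡ false)
all-or-counterexample F []      = inj₁ []
all-or-counterexample F (A ∷ L) with F A in eq | all-or-counterexample F L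
... | false | _ = inj₂ (A , here refl , eq)
... | true  | inj₁ FL = inj₁ (eq ∷ FL)
... | true  | inj₂ (B , B∈ , e) = inj₂ (B , there B∈ , e)

Disj-members : {L : List (Subset n)} {A B : Subset n} → AllPairs Disj L → A ∈ᴸ L → B ∈ᴸ L → A ≡ B ⊎ Disj A B
Disj-members (d ∷ ds) (here refl) (here refl) = inj₁ refl
Disj-members (d ∷ ds) (here refl) (there b)   = inj₂ (All.lookup d b)
Disj-members {A = A} {B} (d ∷ ds) (there a) (here refl) = inj₂ (Disj-sym {A = B} {A} (All.lookup d a))
Disj-members (d ∷ ds) (there a)   (there b)   = Disj-members ds a b

-- If a matching L of the shifted family is not a matching of F, then its image under τ is.
Matching≤-shift : ∀ i (F : Family n) → Matching≤ s F → Matching≤ s (shift i F)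
Matching≤-shift {s = s} i F ν L SL dL with all-or-counterexample F L
... | inj₁ FL = ν L FL dL
... | inj₂ (A , A∈ , ¬FA) = subst (_≤ s) (length-map (τ i) L)
    (ν (map (τ i) L) (All.map⁺ (All.tabulate λ {D} → Fτ D))
      (AllPairs.map⁺ (AllPairs.map (λ {X} {Y} d → trans (disj-τ i X Y) d) dL)))
  where
  A-moved : kind i A ≡ target × F ∋ τ i A
  A-moved with kind i A | All.lookup SL A∈
  ... | source  | SA = contradiction (trans (sym (proj₁ (∧-true⁻ SA))) ¬FA) λ ()
  ... | neutral | SA = contradiction (trans (sym SA) ¬FA) λ ()
  ... | target  | SA with ∨-true⁻ SA
  ...   | inj₁ FA = contradiction (trans (sym FA) ¬FA) λ ()
  ...   | inj₂ x  = refl , x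
  Fτ : ∀ D → D ∈ᴸ L → F ∋ τ i D
  Fτ D D∈ with Disj-members dL A∈ D∈
  ... | inj₁ refl = proj₂ A-moved
  -- Two targets share a point, so `A` is the only target in `L`. A source survives the shift only
  -- together with its target, and neutral sets are fixed by `τ i`.
  ... | inj₂ d with kind i D in eq | All.lookup SL D∈
  ...   | source  | SD = proj₂ (∧-true⁻ {F D} SD)
  ...   | neutral | SD = trans (cong F (τ-neutral i D eq)) SD
  ...   | target  | SD = contradiction d (targets-meet i A D (proj₁ A-moved) eq)

-- Extremal families under shifting

choose : ∀ c (U : Subset n) → c + ∣ U ∣ ≤ n → ∃[ A ] (∣ A ∣ ≡ c × Disj A U)
choose {n} zero U le = ∅ , ∣⊥∣≡0 n , Disj-∅ U
choose (suc c) (false ∷ U) le with choose c U (≤-pred le)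
... | A , e , d = true ∷ A , cong suc e , d
choose {suc n} (suc c) (true ∷ U) le
  with choose (suc c) U (≤-pred (subst (_≤ suc n) (+-suc (suc c) ∣ U ∣) le))
... | A , e , d = false ∷ A , e , d

remove : (A : Subset n) → ∣ A ∣ ≡ suc k → ∃[ B ] B ⋖ A
remove (true ∷ A)  e = false ∷ A , here
remove (false ∷ A) e with remove A e
... | B , c = false ∷ B , there c

Disj-⋖ : {A B U : Subset n} → A ⋖ B → Disj B U → Disj A U
Disj-⋖ {U = false ∷ U} here d = d
Disj-⋖ {U = u ∷ U} (there {b = b} c) d with ∧-true⁻ {not (b ∧ u)} d
... | x , y = ∧-true⁺ x (Disj-⋖ c y)

-- The element of R ∖ R′ is added to A.
transfer : {R′ R : Subset n} (A : Subset n) → R′ ⋖ R → Disj A R → ∃[ B ] (A ⋖ B × Disj R′ B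
  × ¬ Disj R B × (∀ U → Disj A U → Disj R U → Disj B U))
transfer {R = true ∷ R} (false ∷ A) here d =
  true ∷ A , here , Disj-sym {A = A} d , (λ ()) , λ { (false ∷ U) x y → x }
transfer {R = r ∷ R} (a ∷ A) (there c) d with ∧-true⁻ {not (a ∧ r)} d
... | x , y with transfer A c y
... | B , A⋖B , dR , mR , dU = a ∷ B , there A⋖B
  , ∧-true⁺ (trans (cong not (Bool.∧-comm r a)) x) dR
  , (λ z → mR (proj₂ (∧-true⁻ {not (r ∧ a)} z)))
  , λ { (u ∷ U) p q → ∧-true⁺ (proj₁ (∧-true⁻ {not (a ∧ u)} p))
                       (dU U (proj₂ (∧-true⁻ {not (a ∧ u)} p)) (proj₂ (∧-true⁻ {not (r ∧ u)} q))) }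

-- The points of `R` are spent one at a time, each completed by `l` fresh points. When `R` is an
-- extremal set minus one point, the resulting sets join two further disjoint members in a matching
-- that is too large.
blockers : ∀ r l (R U : Subset n) → ∣ R ∣ ≡ r → Disj R U → r + ∣ U ∣ + r * l ≤ n →
  ∃[ L ] (length L ≡ r × AllPairs Disj L × All (Disj U) L
    × All (λ A → ∣ A ∣ ≡ suc l) L × All (λ A → ¬ Disj R A) L)
blockers zero    l R U e d le = [] , refl , [] , [] , [] , []
blockers {n} (suc r) l R U e d le with remove R e
... | R′ , R′⋖R with choose l (R ∪ U) room
  where
  open ≤-Reasoning
  regroup : ∀ r u l x → (l + (r + u)) + x ≡ r + u + (l + x)
  regroup = solve-∀
  room : l + ∣ R ∪ U ∣ ≤ n
  room = begin
    l + ∣ R ∪ U ∣               ≤⟨ +-monoʳ-≤ l (∣∪∣≤ R U) ⟩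
    l + (∣ R ∣ + ∣ U ∣)         ≡⟨ cong (λ z → l + (z + ∣ U ∣)) e ⟩
    l + (suc r + ∣ U ∣)         ≤⟨ m≤m+n _ (r * l) ⟩
    l + (suc r + ∣ U ∣) + r * l ≡⟨ regroup (suc r) ∣ U ∣ l (r * l) ⟩
    suc r + ∣ U ∣ + (l + r * l) ≤⟨ le ⟩
    n                           ∎
... | A , eA , dA with Disj-∪ʳ⁻ A R U dA
... | AR , AU with transfer A R′⋖R AR
... | B , A⋖B , R′B , RB , dB with blockers r l R′ (U ∪ B) eR′
        (Disj-∪ʳ⁺ R′ U B (Disj-⋖ R′⋖R d) R′B) room
  where
  open ≤-Reasoning
  eR′ : ∣ R′ ∣ ≡ r
  eR′ = suc-injective (trans (sym (⋖-size R′⋖R)) e)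
  regroup : ∀ r u l x → r + (u + suc l) + x ≡ suc r + u + (l + x)
  regroup = solve-∀
  room : r + ∣ U ∪ B ∣ + r * l ≤ n
  room = begin
    r + ∣ U ∪ B ∣ + r * l         ≤⟨ +-monoˡ-≤ (r * l) (+-monoʳ-≤ r (∣∪∣≤ U B)) ⟩
    r + (∣ U ∣ + ∣ B ∣) + r * l   ≡⟨ cong (λ z → r + (∣ U ∣ + z) + r * l) (trans (⋖-size A⋖B) (cong suc eA)) ⟩
    r + (∣ U ∣ + suc l) + r * l   ≡⟨ regroup r ∣ U ∣ l (r * l) ⟩
    suc r + ∣ U ∣ + (l + r * l)   ≤⟨ le ⟩
    n                             ∎
... | L , len , dL , uL , sL , mL =
  B ∷ L , cong suc len , All.map (λ {X} → proj₂ ∘ Disj-∪⁻ U B X) uL ∷ dL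
  , Disj-sym {A = B} (dB U AU d) ∷ All.map (λ {X} → proj₁ ∘ Disj-∪⁻ U B X) uL
  , trans (⋖-size A⋖B) (cong suc eA) ∷ sL
  , RB ∷ All.map (λ {X} m x → m (Disj-⋖ R′⋖R x)) mL

Disj-∩ˡ : (A B E : Subset n) → Disj A E → Disj (A ∩ B) E
Disj-∩ˡ []          []          []      d = refl
Disj-∩ˡ (false ∷ A) (b ∷ B)     (e ∷ E) d = Disj-∩ˡ A B E d
Disj-∩ˡ (true ∷ A)  (true ∷ B)  (e ∷ E) d with ∧-true⁻ {not e} d
... | x , y = ∧-true⁺ x (Disj-∩ˡ A B E y)
Disj-∩ˡ (true ∷ A)  (false ∷ B) (e ∷ E) d = Disj-∩ˡ A B E (proj₂ (∧-true⁻ {not e} d))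

Disj-∩ʳ : (A B E : Subset n) → Disj B E → Disj (A ∩ B) E
Disj-∩ʳ A B E d = subst (λ X → Disj X E) (∩-comm B A) (Disj-∩ˡ B A E d)

∣∩τ∣ : ∀ i (A : Subset n) → kind i A ≡ target → suc ∣ A ∩ τ i A ∣ ≡ ∣ A ∣
∣∩τ∣ zero    (false ∷ true ∷ A) e = cong (suc ∘ ∣_∣) (∩-idem A)
∣∩τ∣ zero    (true ∷ true ∷ A)  ()
∣∩τ∣ zero    (true ∷ false ∷ A) ()
∣∩τ∣ zero    (false ∷ false ∷ A) ()
∣∩τ∣ (suc i) (true ∷ A)         e = cong suc (∣∩τ∣ i A e)
∣∩τ∣ (suc i) (false ∷ A)        e = ∣∩τ∣ i A e

target-∪ : ∀ i (A B : Subset n) → kind i A ≡ target → kind i B ≡ target → kind i (A ∪ B) ≡ target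
target-∪ zero (false ∷ true ∷ A) (false ∷ true ∷ B) a b = refl
target-∪ zero (true ∷ true ∷ A)  _ () b
target-∪ zero (true ∷ false ∷ A) _ () b
target-∪ zero (false ∷ false ∷ A) _ () b
target-∪ zero (false ∷ true ∷ A) (true ∷ true ∷ B) a ()
target-∪ zero (false ∷ true ∷ A) (true ∷ false ∷ B) a ()
target-∪ zero (false ∷ true ∷ A) (false ∷ false ∷ B) a ()
target-∪ (suc i) (x ∷ A) (y ∷ B) a b = target-∪ i A B a b

target-∩ : ∀ i (A B : Subset n) → kind i A ≡ target → kind i B ≡ target → 1 ≤ ∣ A ∩ B ∣
target-∩ i A B a b = n≢0⇒n>0 (λ e → targets-meet i A B a b (∣∩∣≡0 A B e))
  where
  ∣∩∣≡0 : ∀ {n} (A B : Subset n) → ∣ A ∩ B ∣ ≡ 0 → Disj A B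
  ∣∩∣≡0 []          []          e = refl
  ∣∩∣≡0 (true ∷ A)  (false ∷ B) e = ∣∩∣≡0 A B e
  ∣∩∣≡0 (false ∷ A) (b ∷ B)     e = ∣∩∣≡0 A B e

-- The shared point saves one. `one-sided` uses this saving twice, and its room count is tight for
-- `s = 1`.
∣∪∣-targets : ∀ i (A B : Subset n) → kind i A ≡ target → kind i B ≡ target → suc ∣ A ∪ B ∣ ≤ ∣ A ∣ + ∣ B ∣
∣∪∣-targets i A B a b = ≤-trans (≤-reflexive (+-comm 1 _))
  (≤-trans (+-monoʳ-≤ ∣ A ∪ B ∣ (target-∩ i A B a b)) (≤-reflexive (∣∪∣+∣∩∣ A B)))

-- U⁺ is U together with the element i.
source-insert : ∀ i (U : Subset n) → kind i U ≡ target →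
  ∃ λ (U⁺ : Subset n) → ∣ U⁺ ∣ ≡ suc ∣ U ∣ ×
  (∀ A → Disj A U⁺ → ∃[ B ] (∣ B ∣ ≡ suc ∣ A ∣ × Disj B U × kind i B ≡ source))
source-insert zero (false ∷ true ∷ U) e = true ∷ true ∷ U , refl ,
  λ { (false ∷ false ∷ A) d → true ∷ false ∷ A , refl , d , refl }
source-insert zero (true ∷ true ∷ A)  ()
source-insert zero (true ∷ false ∷ A) ()
source-insert zero (false ∷ false ∷ A) ()
source-insert (suc i) (u ∷ U) e with source-insert i U e
... | U⁺ , eU , ins = u ∷ U⁺ , size-∷ u , step
  where
  size-∷ : ∀ u → ∣ u ∷ U⁺ ∣ ≡ suc ∣ u ∷ U ∣
  size-∷ true  = cong suc eU
  size-∷ false = eU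
  step : ∀ A → Disj A (u ∷ U⁺) → ∃[ B ] (∣ B ∣ ≡ suc ∣ A ∣ × Disj B (u ∷ U) × kind (suc i) B ≡ source)
  step (a ∷ A) d with ∧-true⁻ {not (a ∧ u)} d
  ... | x , y with ins A y
  step (true ∷ A)  d | x , y | B , eB , dB , kB = true ∷ B , cong suc eB , ∧-true⁺ x dB , kB
  step (false ∷ A) d | x , y | B , eB , dB , kB = false ∷ B , eB , dB , kB

meeting⇒size : ∀ k (W B : Subset n) → meeting k W ∋ B → ∣ B ∣ ≡ k
meeting⇒size k W B m = ≡ᵇ-true ∣ B ∣ k (proj₁ (∧-true⁻ {ofSize k B} m))

meeting⇒¬Disj : ∀ k (W B : Subset n) → meeting k W ∋ B → ¬ Disj W B
meeting⇒¬Disj k W B m d with trans (sym (proj₂ (∧-true⁻ {ofSize k B} m))) (cong not d)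
... | ()

meeting-τ : ∀ i k (W B : Subset n) → meeting k W (τ i B) ≡ meeting k (τ i W) B
meeting-τ i k W B = cong₂ (λ x d → (x ≡ᵇ k) ∧ not d) (∣τ∣ i B) (sym (disj-τˡ i W B))

source? : (κ : Kind) → Dec (κ ≡ source)
source? source  = yes refl
source? target  = no λ ()
source? neutral = no λ ()

module _ {s l : ℕ} (i : Fin n) (F : Family n) (S : Subset n)
         (s≥1 : 1 ≤ s) (room : (2 * s + 1) * l + suc s ≤ n) (∣S∣≡s : ∣ S ∣ ≡ s)
         (unif : Uniform (suc l) F) (ν : Matching≤ s F)
         (extremal : ∀ A → shift i F A ≡ meeting (suc l) S A) where

  private
    M : Family n
    M = meeting (suc l) S

    -- If the conjunction and the disjunction of `F A` and `F (τ i A)` agree, both values agree, so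
    -- the shift has changed nothing.
    unmoved : (∀ A → kind i A ≡ source → M A ≡ M (τ i A)) → ∀ A → F A ≡ M A
    unmoved same A with kind i A in eq
    ... | neutral = trans (sym (shift-neutral i F A eq)) (extremal A)
    ... | source  = trans (bool (F A) _ (trans (sym (shift-source i F A eq)) (trans (extremal A)
          (trans (same A eq) (trans (sym (extremal (τ i A))) (shift-τ-source i F A eq))))))
        (trans (sym (shift-source i F A eq)) (extremal A))
      where
      bool : ∀ a b → a ∧ b ≡ b ∨ a → a ≡ a ∧ b
      bool true  true  e = refl
      bool false b     e = refl
      bool true  false e = sym e
    ... | target  = trans (bool (F A) _ (trans (sym (shift-target i F A eq)) (trans (extremal A)
          (trans (sym (trans (same (τ i A) (kind-τ-of i A eq)) (cong M (τ-involutive i A))))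
            (trans (sym (extremal (τ i A))) (shift-τ-target i F A eq))))))
        (trans (sym (shift-target i F A eq)) (extremal A))
      where
      bool : ∀ a b → a ∨ b ≡ b ∧ a → a ≡ a ∨ b
      bool true  b     e = refl
      bool false true  ()
      bool false false e = refl

    neutral-case : kind i S ≡ neutral → ∀ A → F A ≡ M A
    neutral-case eS = unmoved λ A _ →
      sym (trans (meeting-τ i (suc l) S A) (cong (λ X → meeting (suc l) X A) (τ-neutral i S eS)))

    -- Every source of the right size shares a point with `S`, and a source in the shifted family
    -- always has its target there too. Hence `M` does not separate sources from targets.
    source-case : kind i S ≡ source → ∀ A → F A ≡ M A
    source-case eS = unmoved λ A eA → Bool-ext
      (λ MA → trans (sym (extremal (τ i A))) (trans (shift-τ-source i F A eA)
        (∨-trueʳ (F (τ i A)) (proj₁ (∧-true⁻ {F A} (trans (sym (shift-source i F A eA)) (trans (extremal A) MA)))))))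
      (λ Mτ → meeting-intro (suc l) S A (trans (sym (∣τ∣ i A)) (meeting⇒size (suc l) S (τ i A) Mτ))
        (sources-meet i S A eS eA))
      where
      ∨-trueʳ : ∀ a {b} → b ≡ true → a ∨ b ≡ true
      ∨-trueʳ a refl = Bool.∨-zeroʳ a

    module _ (eS : kind i S ≡ target) where

      -- `S ∩ τ i S` is `S` without its point in the shifted pair, so it supplies `s - 1` blockers.
      -- They avoid both points of the pair, occupied by `τ i P` and `Q`; hence they are neutral and
      -- already belong to `F`. With `τ i P` and `Q` they would form `s + 1` disjoint members.
      conflict : ∀ P Q → kind i P ≡ source → kind i Q ≡ source → F ∋ τ i P → F ∋ Q →
        Disj S P → Disj S Q → ¬ Disj (τ i P) Q
      conflict P Q kP kQ FP FQ SP SQ d with blockers (∣ S ∩ τ i S ∣) l (S ∩ τ i S) (τ i P ∪ Q) refl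
        (Disj-∪ʳ⁺ (S ∩ τ i S) (τ i P) Q (Disj-∩ʳ S (τ i S) (τ i P) (trans (disj-τ i S P) SP))
          (Disj-∩ˡ S (τ i S) Q SQ)) enough
        where
        open ≤-Reasoning
        r = ∣ S ∩ τ i S ∣
        sr : suc r ≡ s
        sr = trans (∣∩τ∣ i S eS) ∣S∣≡s
        regroup₁ : ∀ r l → r + (suc l + suc l) + r * l ≡ suc r * l + l + suc (suc r)
        regroup₁ = solve-∀
        regroup₂ : ∀ s l → 2 * s * l + l + suc s ≡ (2 * s + 1) * l + suc s
        regroup₂ = solve-∀
        enough : r + ∣ τ i P ∪ Q ∣ + r * l ≤ n
        enough = begin
          r + ∣ τ i P ∪ Q ∣ + r * l         ≤⟨ +-monoˡ-≤ (r * l) (+-monoʳ-≤ r (∣∪∣≤ (τ i P) Q)) ⟩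
          r + (∣ τ i P ∣ + ∣ Q ∣) + r * l   ≡⟨ cong₂ (λ x y → r + (x + y) + r * l) (unif _ FP) (unif _ FQ) ⟩
          r + (suc l + suc l) + r * l       ≡⟨ regroup₁ r l ⟩
          suc r * l + l + suc (suc r)       ≡⟨ cong (λ z → z * l + l + suc z) sr ⟩
          s * l + l + suc s                 ≤⟨ +-monoˡ-≤ (suc s) (+-monoˡ-≤ l (*-monoˡ-≤ l (m≤m+n s (1 * s)))) ⟩
          2 * s * l + l + suc s             ≡⟨ regroup₂ s l ⟩
          (2 * s + 1) * l + suc s           ≤⟨ room ⟩
          n                                 ∎
      ... | L , len , dL , uL , sL , mL = n≮n s (subst (_≤ s)
          (cong suc (trans (cong suc len) (trans (∣∩τ∣ i S eS) ∣S∣≡s)))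
          (ν (τ i P ∷ Q ∷ L) (FP ∷ FQ ∷ All.tabulate inF) ((d ∷ All.map (λ {X} → proj₁ ∘ Disj-∪⁻ (τ i P) Q X) uL)
            ∷ All.map (λ {X} → proj₂ ∘ Disj-∪⁻ (τ i P) Q X) uL ∷ dL)))
        where
        inF : ∀ {Z} → Z ∈ᴸ L → F ∋ Z
        inF {Z} Z∈ with Disj-∪⁻ (τ i P) Q Z (All.lookup uL Z∈)
        ... | PZ , QZ = trans (sym (shift-neutral i F Z
            (neutral-if-disjoint i (τ i P) Q Z (kind-τ-of i P kP) kQ PZ QZ)))
          (trans (extremal Z) (meeting-intro (suc l) S Z (All.lookup sL Z∈)
            (λ SZ → All.lookup mL Z∈ (Disj-∩ˡ S (τ i S) Z SZ))))

      -- The third set, disjoint from τ P and τ Q, conflicts with one of P, Q whether or not it was moved.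
      one-sided : ∀ P Q → kind i P ≡ source → kind i Q ≡ source → F ∋ τ i P → F ∋ Q →
        Disj S P → ¬ Disj S Q
      one-sided P Q kP kQ FP FQ SP SQ with source-insert i (τ i P ∪ S ∪ τ i Q) kU
        where
        kU : kind i (τ i P ∪ S ∪ τ i Q) ≡ target
        kU = target-∪ i (τ i P) (S ∪ τ i Q) (kind-τ-of i P kP) (target-∪ i S (τ i Q) eS (kind-τ-of i Q kQ))
      ... | U⁺ , eU⁺ , insert with choose l U⁺ enough
        where
        open ≤-Reasoning
        pos : l + l ≤ 2 * s * l
        pos = ≤-trans (≤-reflexive (double l)) (*-monoˡ-≤ l (*-monoʳ-≤ 2 s≥1))
          where
          double : ∀ l → l + l ≡ 2 * 1 * l
          double = solve-∀
        regroup₁ : ∀ s l → l + (l + (s + suc l)) ≡ l + l + l + suc s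
        regroup₁ = solve-∀
        regroup₂ : ∀ s l → 2 * s * l + l + suc s ≡ (2 * s + 1) * l + suc s
        regroup₂ = solve-∀
        enough : l + ∣ U⁺ ∣ ≤ n
        enough = begin
          l + ∣ U⁺ ∣                              ≡⟨ cong (l +_) eU⁺ ⟩
          l + suc ∣ τ i P ∪ S ∪ τ i Q ∣
            ≤⟨ +-monoʳ-≤ l (∣∪∣-targets i (τ i P) (S ∪ τ i Q) (kind-τ-of i P kP)
                 (target-∪ i S (τ i Q) eS (kind-τ-of i Q kQ))) ⟩
          l + (∣ τ i P ∣ + ∣ S ∪ τ i Q ∣)         ≡⟨ cong (λ z → l + (z + ∣ S ∪ τ i Q ∣)) (unif _ FP) ⟩
          l + (suc l + ∣ S ∪ τ i Q ∣)             ≡⟨ cong (l +_) (+-suc l ∣ S ∪ τ i Q ∣) ⟨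
          l + (l + suc ∣ S ∪ τ i Q ∣)
            ≤⟨ +-monoʳ-≤ l (+-monoʳ-≤ l (∣∪∣-targets i S (τ i Q) eS (kind-τ-of i Q kQ))) ⟩
          l + (l + (∣ S ∣ + ∣ τ i Q ∣))           ≡⟨ cong₂ (λ x y → l + (l + (x + y))) ∣S∣≡s (trans (∣τ∣ i Q) (unif _ FQ)) ⟩
          l + (l + (s + suc l))                   ≡⟨ regroup₁ s l ⟩
          l + l + l + suc s                       ≤⟨ +-monoˡ-≤ (suc s) (+-monoˡ-≤ l pos) ⟩
          2 * s * l + l + suc s                   ≡⟨ regroup₂ s l ⟩
          (2 * s + 1) * l + suc s                 ≤⟨ room ⟩
          n                                       ∎
      ... | A , eA , dA with insert A dA
      ... | B , eB , dB , kB with Disj-∪ʳ⁻ B (τ i P) (S ∪ τ i Q) dB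
      ... | BP , BSQ with Disj-∪ʳ⁻ B S (τ i Q) BSQ
      ... | BS , BQ with ∨-true⁻ (trans (sym (shift-τ-source i F B kB)) (trans (extremal (τ i B))
              (meeting-intro (suc l) S (τ i B) (trans (∣τ∣ i B) (trans eB (cong suc eA)))
                (targets-meet i S (τ i B) eS (kind-τ-of i B kB)))))
      ...   | inj₁ FτB = conflict B Q kB kQ FτB FQ (Disj-sym {A = B} BS) SQ (trans (disj-τˡ i B Q) BQ)
      ...   | inj₂ FB  = conflict P B kP kB FP FB SP (Disj-sym {A = B} BS) (Disj-sym {A = B} BP)

      -- For a source `P` of size `suc l` disjoint from `S`, the shifted family contains `τ i P` but
      -- not `P`, so `F` contains exactly one of them. By `one-sided` the choice is the same for all
      -- such `P`: targets give the star of `S`, sources that of `τ i S`.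
      target-case : ∃[ S′ ] (∣ S′ ∣ ≡ s × (∀ A → F A ≡ meeting (suc l) S′ A))
      target-case with anySubset? (λ P → source? (kind i P) ×-dec (disj S P Bool.≟ true) ×-dec (F (τ i P) Bool.≟ true))
      ... | yes (P , kP , SP , FP) = S , ∣S∣≡s , λ A → Bool-ext (to A) (from A)
        where
        to : ∀ A → F ∋ A → M ∋ A
        to A FA = meeting-intro (suc l) S A (unif A FA) (apart (kind i A) refl)
          where
          apart : ∀ κ → kind i A ≡ κ → ¬ Disj S A
          apart source  eA = one-sided P A kP eA FP FA SP
          apart target  eA = targets-meet i S A eS eA
          apart neutral eA = meeting⇒¬Disj (suc l) S A
            (trans (sym (extremal A)) (trans (shift-neutral i F A eA) FA))
        from : ∀ A → M ∋ A → F ∋ A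
        from A MA = by-kind (kind i A) refl
          where
          SA = trans (extremal A) MA
          by-kind : ∀ κ → kind i A ≡ κ → F ∋ A
          by-kind source  eA = proj₁ (∧-true⁻ (trans (sym (shift-source i F A eA)) SA))
          by-kind neutral eA = trans (sym (shift-neutral i F A eA)) SA
          by-kind target  eA with ∨-true⁻ (trans (sym (shift-target i F A eA)) SA)
          ... | inj₁ FA = FA
          ... | inj₂ Fτ = proj₂ (∧-true⁻ {F (τ i A)} (trans (sym (shift-τ-target i F A eA)) (trans (extremal (τ i A))
            (meeting-intro (suc l) S (τ i A) (unif _ Fτ)
              (one-sided P (τ i A) kP (kind-τ-of i A eA) FP Fτ SP)))))
      ... | no none = τ i S , trans (∣τ∣ i S) ∣S∣≡s , λ A → Bool-ext (to A) (from A)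
        where
        to : ∀ A → F ∋ A → meeting (suc l) (τ i S) ∋ A
        to A FA = meeting-intro (suc l) (τ i S) A (unif A FA) (apart (kind i A) refl)
          where
          apart : ∀ κ → kind i A ≡ κ → ¬ Disj (τ i S) A
          apart source  eA = sources-meet i (τ i S) A (kind-τ-of i S eS) eA
          apart target  eA d = none (τ i A , kind-τ-of i A eA , trans (sym (disj-τˡ i S A)) d
            , trans (cong F (τ-involutive i A)) FA)
          apart neutral eA d = meeting⇒¬Disj (suc l) S A
            (trans (sym (extremal A)) (trans (shift-neutral i F A eA) FA))
            (trans (cong (disj S) (sym (τ-neutral i A eA))) (trans (sym (disj-τˡ i S A)) d))
        from : ∀ A → meeting (suc l) (τ i S) ∋ A → F ∋ A
        from A m = by-kind (kind i A) refl
          where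
          ∣A∣ = meeting⇒size (suc l) (τ i S) A m
          MτA : M ∋ τ i A
          MτA = trans (meeting-τ i (suc l) S A) m
          by-kind : ∀ κ → kind i A ≡ κ → F ∋ A
          by-kind target  eA = proj₂ (∧-true⁻ {F (τ i A)} (trans (sym (shift-τ-target i F A eA)) (trans (extremal (τ i A)) MτA)))
          by-kind neutral eA = trans (sym (shift-neutral i F A eA)) (trans (extremal A)
            (trans (cong M (sym (τ-neutral i A eA))) MτA))
          by-kind source  eA with ∨-true⁻ (trans (sym (shift-τ-source i F A eA)) (trans (extremal (τ i A)) MτA))
          ... | inj₂ FA = FA
          ... | inj₁ Fτ = proj₁ (∧-true⁻ (trans (sym (shift-source i F A eA)) (trans (extremal A)
            (meeting-intro (suc l) S A ∣A∣ (λ SA → none (A , eA , SA , Fτ))))))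

  unshift-extremal : ∃[ S′ ] (∣ S′ ∣ ≡ s × (∀ A → F A ≡ meeting (suc l) S′ A))
  unshift-extremal = by-kind (kind i S) refl
    where
    by-kind : ∀ κ → kind i S ≡ κ → ∃[ S′ ] (∣ S′ ∣ ≡ s × (∀ A → F A ≡ meeting (suc l) S′ A))
    by-kind source  eS = S , ∣S∣≡s , source-case eS
    by-kind neutral eS = S , ∣S∣≡s , neutral-case eS
    by-kind target  eS = target-case eS

-- Frankl's theorem

frankl-bound : ℕ → ℕ → ℕ → ℕ
frankl-bound n k s = (n C k) ∸ ((n ∸ s) C k)

Extremal : ℕ → ℕ → Family n → Set
Extremal {n} k s F = ∃ λ (S : Subset n) → ∣ S ∣ ≡ s × (∀ A → F A ≡ meeting k S A)

Frankl : ∀ (s l : ℕ) → Family n → Set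
Frankl {n} s l F = size F ≤ frankl-bound n (suc l) s
  × (size F ≡ frankl-bound n (suc l) s → Extremal (suc l) s F)

frankl-stable : ∀ s l N → N + suc s ≡ n → 1 ≤ s → (2 * s + 1) * l ≤ N → (F : Family n) →
  Uniform (suc l) F → Stable F → Matching≤ s F → Frankl s l F
frankl-stable s l N refl s≥1 room F unif stab ν =
  ≤-trans (stable-bound F s≥1 room unif stab ν) (≤-reflexive size-M) ,
  λ e → tail-set N s , ∣tail-set∣ N s , stable-equality F s≥1 room unif stab ν (trans e (sym size-M))
  where
  size-M : size (meeting (suc l) (tail-set N s)) ≡ frankl-bound (N + suc s) (suc l) s
  size-M = trans (size-meeting (suc l) (tail-set N s))
    (cong (λ z → ((N + suc s) C suc l) ∸ ((N + suc s ∸ z) C suc l)) (∣tail-set∣ N s))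

frankl : ∀ s l → 1 ≤ s → (2 * s + 1) * l + suc s ≤ n → (F : Family n) →
  Uniform (suc l) F → Matching≤ s F → Frankl s l F
frankl {n} s l s≥1 room F₀ unif₀ ν₀ = go F₀ (<-wellFounded (potential F₀)) unif₀ ν₀
  where
  go : ∀ F → Acc _<_ (potential F) → Uniform (suc l) F → Matching≤ s F → Frankl s l F
  go F (acc rec) unif ν with any? (λ i → anySubset? (λ A →
      source? (kind i A) ×-dec (F A Bool.≟ true) ×-dec (F (τ i A) Bool.≟ false)))
  ... | yes (i , A , src , FA , FτA)
    with go (shift i F) (rec (potential-shift i F A src FA FτA)) (Uniform-shift i F unif) (Matching≤-shift i F ν)
  ...   | le , extr = subst (_≤ frankl-bound n (suc l) s) (size-shift i F) le , λ e → unshift (extr (trans (size-shift i F) e))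
    where
    unshift : Extremal (suc l) s (shift i F) → Extremal (suc l) s F
    unshift (S , eS , all) = unshift-extremal i F S s≥1 room eS unif ν all
  go F (acc rec) unif ν | no none = frankl-stable s l (n ∸ suc s)
      (m∸n+n≡m (≤-trans (m≤n+m (suc s) ((2 * s + 1) * l)) room)) s≥1 (m+n≤o⇒m≤o∸n _ room) F unif
      (Stable-adjacent F adjacent) ν
    where
    adjacent : ∀ i A → kind i A ≡ source → F ∋ A → F ∋ τ i A
    adjacent i A src FA with F (τ i A) in eq
    ... | true  = refl
    ... | false = contradiction (i , A , src , FA , eq) none

-- Multisets as sets

support : Multiset n → Subset n
support []          = []
support (zero ∷ A)  = false ∷ support A
support (suc a ∷ A) = true ∷ support A

-- A positive multiplicity becomes a `false`, opening the run, followed by one `true` per further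
-- repetition. The number of `true` bits is thus the cardinality minus the size of the support,
-- which gives all codes the same size.
runs : Multiset n → List Bool
runs []          = []
runs (zero ∷ A)  = runs A
runs (suc a ∷ A) = false ∷ List.replicate a true List.++ runs A

length-runs : (A : Multiset n) → length (runs A) ≡ card A
length-runs []          = refl
length-runs (zero ∷ A)  = length-runs A
length-runs (suc a ∷ A) = cong suc (trans (length-++ (List.replicate a true))
  (cong₂ _+_ (length-replicate a) (length-runs A)))

-- A leading `true` would continue the preceding run; excluding it makes the division into runs
-- unique.
data NoLeadingTrue : List Bool → Set where
  empty : NoLeadingTrue []
  false : ∀ {bs} → NoLeadingTrue (false ∷ bs)

runs-lead : (A : Multiset n) → NoLeadingTrue (runs A)
runs-lead []          = empty
runs-lead (zero ∷ A)  = runs-lead A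
runs-lead (suc a ∷ A) = false

replicate-++-injective : ∀ a b {xs ys} → NoLeadingTrue xs → NoLeadingTrue ys →
  List.replicate a true List.++ xs ≡ List.replicate b true List.++ ys → a ≡ b × xs ≡ ys
replicate-++-injective zero    zero    x y e = refl , e
replicate-++-injective (suc a) (suc b) x y e
  with replicate-++-injective a b x y (proj₂ (∷-injective e))
... | refl , e′ = refl , e′
replicate-++-injective zero    (suc b) empty y ()
replicate-++-injective zero    (suc b) false y ()
replicate-++-injective (suc a) zero    x empty ()
replicate-++-injective (suc a) zero    x false ()

runs-injective : (A B : Multiset n) → support A ≡ support B → runs A ≡ runs B → A ≡ B
runs-injective []          []          e f = refl
runs-injective (zero ∷ A)  (zero ∷ B)  e f = cong (zero ∷_) (runs-injective A B (Vec.∷-injectiveʳ e) f)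
runs-injective (suc a ∷ A) (suc b ∷ B) e f
  with replicate-++-injective a b (runs-lead A) (runs-lead B) (proj₂ (∷-injective f))
... | refl , f′ = cong (suc a ∷_) (runs-injective A B (Vec.∷-injectiveʳ e) f′)
runs-injective (zero ∷ A)  (suc b ∷ B) () f
runs-injective (suc a ∷ A) (zero ∷ B)  () f

#false #true : List Bool → ℕ
#false []           = 0
#false (true ∷ bs)  = #false bs
#false (false ∷ bs) = suc (#false bs)
#true []           = 0
#true (true ∷ bs)  = suc (#true bs)
#true (false ∷ bs) = #true bs

#false-lead : ∀ bs → ∃[ a ] ∃[ bs′ ] (bs ≡ List.replicate a true List.++ bs′ × NoLeadingTrue bs′ × #false bs′ ≡ #false bs)
#false-lead []           = 0 , [] , refl , empty , refl
#false-lead (false ∷ bs) = 0 , false ∷ bs , refl , false , refl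
#false-lead (true ∷ bs) with #false-lead bs
... | a , bs′ , refl , lead , e = suc a , bs′ , refl , lead , e

-- Each `false` opens a run and each point of `S` takes one, so equal counts let the runs be dealt
-- out in order.
decode : (S : Subset n) (bs : List Bool) → NoLeadingTrue bs → #false bs ≡ ∣ S ∣ →
  ∃[ A ] (support A ≡ S × runs A ≡ bs)
decode []          []  empty e = [] , refl , refl
decode (false ∷ S) bs  lead  e with decode S bs lead e
... | A , eS , eR = zero ∷ A , cong (false ∷_) eS , eR
decode (true ∷ S) (false ∷ bs) false e with #false-lead bs
... | a , bs′ , refl , lead , e′ with decode S bs′ lead (trans e′ (suc-injective e))
...   | A , refl , refl = suc a ∷ A , refl , refl

∣support∣ : (A : Multiset n) → ∣ support A ∣ + #true (runs A) ≡ card A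
∣support∣ []          = refl
∣support∣ (zero ∷ A)  = ∣support∣ A
∣support∣ (suc a ∷ A) = cong suc (trans (cong (∣ support A ∣ +_) (#true-++ a))
  (trans (rotate ∣ support A ∣ a _) (cong (a +_) (∣support∣ A))))
  where
  #true-++ : ∀ a {bs} → #true (List.replicate a true List.++ bs) ≡ a + #true bs
  #true-++ zero    = refl
  #true-++ (suc a) = cong suc (#true-++ a)
  rotate : ∀ x y z → x + (y + z) ≡ y + (x + z)
  rotate = solve-∀

bits : ∀ l → List Bool → Subset l
bits zero    bs       = []
bits (suc l) []       = false ∷ bits l []
bits (suc l) (b ∷ bs) = b ∷ bits l bs

∣bits∣ : ∀ l bs → length bs ≡ l → ∣ bits l bs ∣ ≡ #true bs
∣bits∣ zero    []           e = refl
∣bits∣ (suc l) (true ∷ bs)  e = cong suc (∣bits∣ l bs (suc-injective e))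
∣bits∣ (suc l) (false ∷ bs) e = ∣bits∣ l bs (suc-injective e)

bits-injective : ∀ l as bs → length as ≡ l → length bs ≡ l → bits l as ≡ bits l bs → as ≡ bs
bits-injective zero    []       []       e f g = refl
bits-injective (suc l) (a ∷ as) (b ∷ bs) e f g =
  cong₂ _∷_ (Vec.∷-injectiveˡ g) (bits-injective l as bs (suc-injective e) (suc-injective f) (Vec.∷-injectiveʳ g))

bits-toList : (T : Subset n) → bits n (Vec.toList T) ≡ T
bits-toList []      = refl
bits-toList (b ∷ T) = cong (b ∷_) (bits-toList T)

#false-toList : (T : Subset n) → #false (Vec.toList T) + ∣ T ∣ ≡ n
#false-toList []          = refl
#false-toList (true ∷ T)  = trans (+-suc _ _) (cong suc (#false-toList T))
#false-toList (false ∷ T) = cong suc (#false-toList T)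

-- The support followed by the runs; the first run bit of a nonempty multiset is always false and is dropped.
encode : ∀ {m} l → Multiset m → Subset (m + l)
encode l A = support A ++ bits l (List.drop 1 (runs A))

runs-nonempty : ∀ {l} (A : Multiset n) → IsKMultiset (suc l) A →
  ∃[ bs ] (runs A ≡ false ∷ bs × length bs ≡ l)
runs-nonempty A e with runs A | runs-lead A | trans (length-runs A) e
... | []         | empty | ()
... | false ∷ bs | false | f = bs , refl , suc-injective f

encode-size : ∀ l (A : Multiset n) → IsKMultiset (suc l) A → ∣ encode l A ∣ ≡ suc l
encode-size l A e with runs-nonempty A e
... | bs , eR , len = begin
  ∣ encode l A ∣                                ≡⟨ ∣++∣ (support A) _ ⟩
  ∣ support A ∣ + ∣ bits l (List.drop 1 (runs A)) ∣ ≡⟨ cong (λ r → ∣ support A ∣ + ∣ bits l (List.drop 1 r) ∣) eR ⟩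
  ∣ support A ∣ + ∣ bits l bs ∣                 ≡⟨ cong (∣ support A ∣ +_) (∣bits∣ l bs len) ⟩
  ∣ support A ∣ + #true bs                      ≡⟨ cong (λ r → ∣ support A ∣ + #true r) eR ⟨
  ∣ support A ∣ + #true (runs A)                ≡⟨ ∣support∣ A ⟩
  card A                                        ≡⟨ e ⟩
  suc l                                         ∎
  where open ≡-Reasoning

encode-injective : ∀ l (A B : Multiset n) → IsKMultiset (suc l) A → IsKMultiset (suc l) B →
  encode l A ≡ encode l B → A ≡ B
encode-injective l A B eA eB e with runs-nonempty A eA | runs-nonempty B eB
... | as , rA , lA | bs , rB , lB = runs-injective A B (proj₁ halves)
  (trans rA (trans (cong (false ∷_) (bits-injective l as bs lA lB
    (trans (cong (bits l ∘ List.drop 1) (sym rA)) (trans (proj₂ halves) (cong (bits l ∘ List.drop 1) rB))))) (sym rB)))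
  where
  halves = Vec.++-injective (support A) (support B) e

-- Lets the family of all multisets meeting a set fill the whole star of that set, so that its size
-- is exactly the bound.
encode-surjective : ∀ {m} l (B : Subset (m + l)) → ∣ B ∣ ≡ suc l →
  ∃ λ (A : Multiset m) → IsKMultiset (suc l) A × encode l A ≡ B
encode-surjective {m} l B e with splitAt m B
... | S , T , refl with decode S (false ∷ Vec.toList T) false falses
  where
  falses : suc (#false (Vec.toList T)) ≡ ∣ S ∣
  falses = +-cancelʳ-≡ ∣ T ∣ _ _ (trans (cong suc (#false-toList T)) (trans (sym e) (∣++∣ S T)))
... | A , eS , eR = A
  , trans (sym (length-runs A)) (trans (cong length eR) (cong suc (Vec.length-toList T)))
  , cong₂ _++_ eS (trans (cong (bits l ∘ List.drop 1) eR) (bits-toList T))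

support-disjoint : (A B : Multiset n) → Disj (support A) (support B) → Disjoint A B
support-disjoint (zero ∷ A)  (b ∷ B)     d zero    = refl
support-disjoint (suc a ∷ A) (zero ∷ B)  d zero    = refl
support-disjoint (zero ∷ A)  (zero ∷ B)  d (suc i) = support-disjoint A B d i
support-disjoint (zero ∷ A)  (suc b ∷ B) d (suc i) = support-disjoint A B d i
support-disjoint (suc a ∷ A) (zero ∷ B)  d (suc i) = support-disjoint A B d i

intersects⇒ : (S : Subset n) (A : Multiset n) → IntersectsSet S A → ¬ Disj S (support A)
intersects⇒ (true ∷ S) (suc a ∷ A) (zero , here , _) ()
intersects⇒ (b ∷ S) (zero ∷ A)  (suc i , there i∈ , le) d =
  intersects⇒ S A (i , i∈ , le) (proj₂ (∧-true⁻ {not (b ∧ false)} d))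
intersects⇒ (b ∷ S) (suc a ∷ A) (suc i , there i∈ , le) d =
  intersects⇒ S A (i , i∈ , le) (proj₂ (∧-true⁻ {not (b ∧ true)} d))

intersects⇐ : (S : Subset n) (A : Multiset n) → ¬ Disj S (support A) → IntersectsSet S A
intersects⇐ []          []          nd = contradiction refl nd
intersects⇐ (true ∷ S)  (suc a ∷ A) nd = zero , here , s≤s z≤n
intersects⇐ (true ∷ S)  (zero ∷ A)  nd with intersects⇐ S A nd
... | i , i∈ , le = suc i , there i∈ , le
intersects⇐ (false ∷ S) (zero ∷ A)  nd with intersects⇐ S A nd
... | i , i∈ , le = suc i , there i∈ , le
intersects⇐ (false ∷ S) (suc a ∷ A) nd with intersects⇐ S A nd
... | i , i∈ , le = suc i , there i∈ , le

-- From lists of multisets to families of sets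

_≟ˢ_ : (A B : Subset n) → Dec (A ≡ B)
_≟ˢ_ = Vec.≡-dec Bool._≟_

module _ {n : ℕ} where
  open import Data.List.Membership.DecPropositional (_≟ˢ_ {n}) using (_∈?_) public

members : List (Subset n) → Family n
members L A = does (A ∈? L)

members⇒ : (L : List (Subset n)) (A : Subset n) → members L ∋ A → A ∈ᴸ L
members⇒ L A e with A ∈? L
... | yes A∈ = A∈

members⇐ : (L : List (Subset n)) (A : Subset n) → A ∈ᴸ L → members L ∋ A
members⇐ L A A∈ = dec-true (A ∈? L) A∈

∑-point : (A : Subset n) (f : Subset n → ℕ) → (∀ B → B ≢ A → f B ≡ 0) → ∑ f ≡ f A
∑-point []          f off = refl
∑-point {suc n} (true ∷ A)  f off = trans (cong₂ _+_
    (∑-point A (f ∘ (true ∷_)) (λ B ne → off (true ∷ B) (ne ∘ Vec.∷-injectiveʳ)))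
    (trans (∑-cong (λ B → off (false ∷ B) λ ())) (size-empty n))) (+-identityʳ _)
∑-point {suc n} (false ∷ A) f off = cong₂ _+_
    (trans (∑-cong (λ B → off (true ∷ B) λ ())) (size-empty n))
    (∑-point A (f ∘ (false ∷_)) (λ B ne → off (false ∷ B) (ne ∘ Vec.∷-injectiveʳ)))

size-members : (L : List (Subset n)) → Unique L → size (members L) ≡ length L
size-members {n} []      []      = size-empty n
size-members     (A ∷ L) (A∉ ∷ uniq) = begin
  size (members (A ∷ L))                    ≡⟨ ∑-cong step ⟩
  (∑ λ B → 𝟙 (does (B ≟ˢ A)) + 𝟙 (members L B)) ≡⟨ ∑-+ (λ B → 𝟙 (does (B ≟ˢ A))) _ ⟩
  (∑ λ B → 𝟙 (does (B ≟ˢ A))) + size (members L)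
    ≡⟨ cong₂ _+_ (trans (∑-point A _ (λ B ne → cong 𝟙 (dec-false (B ≟ˢ A) ne))) (cong 𝟙 (dec-true (A ≟ˢ A) refl)))
         (size-members L uniq) ⟩
  suc (length L)                            ∎
  where
  open ≡-Reasoning
  step : ∀ B → 𝟙 (members (A ∷ L) B) ≡ 𝟙 (does (B ≟ˢ A)) + 𝟙 (members L B)
  step B with B ≟ˢ A
  ... | no _     = refl
  ... | yes refl = cong (suc ∘ 𝟙) (sym (dec-false (A ∈? L) (λ A∈ → All.lookup A∉ A∈ refl)))

Disj-take : ∀ m {p} (A B : Subset (m + p)) → Disj A B → Disj (Vec.take m A) (Vec.take m B)
Disj-take zero    A       B       d = refl
Disj-take (suc m) (a ∷ A) (b ∷ B) d with ∧-true⁻ {not (a ∧ b)} d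
... | x , y = ∧-true⁺ x (Disj-take m A B y)

take-++ : ∀ {m p} (u : Subset m) (v : Subset p) → Vec.take m (u ++ v) ≡ u
take-++ []      v = refl
take-++ (b ∷ u) v = cong (b ∷_) (take-++ u v)

Disj-take-∪ : ∀ {m p} (T₁ T₂ : Subset m) (x : Subset p) Z → Disj ((T₁ ∪ T₂) ++ x) Z →
  Disj (Vec.take m (T₁ ++ x)) (Vec.take m Z) × Disj (Vec.take m (T₂ ++ x)) (Vec.take m Z)
Disj-take-∪ {m} T₁ T₂ x Z d with Disj-∪⁻ T₁ T₂ (Vec.take m Z)
  (subst (λ A → Disj A (Vec.take m Z)) (take-++ (T₁ ∪ T₂) x) (Disj-take m ((T₁ ∪ T₂) ++ x) Z d))
... | d₁ , d₂ = subst (λ A → Disj A (Vec.take m Z)) (sym (take-++ T₁ x)) d₁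
              , subst (λ A → Disj A (Vec.take m Z)) (sym (take-++ T₂ x)) d₂

card-self-disjoint : (A : Multiset n) → Disjoint A A → card A ≡ 0
card-self-disjoint []      d = refl
card-self-disjoint (a ∷ A) d =
  cong₂ _+_ (trans (sym (⊓-idem a)) (d zero)) (card-self-disjoint A (d ∘ suc))

disj-++-∅ : ∀ {m p} (S : Subset m) (u : Subset m) (v : Subset p) → disj (S ++ ∅) (u ++ v) ≡ disj S u
disj-++-∅ S u v = trans (disj-++ S u ∅ v) (trans (cong (disj S u ∧_) (Disj-∅ v)) (Bool.∧-identityʳ _))

module Transport {m s l : ℕ} (F : List (Multiset m)) (uniq : Unique F)
                 (card-F : All (IsKMultiset (suc l)) F) (ν : NoMoreThanPairwiseDisjoint s F) where

  𝓕 : Family (m + l)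
  𝓕 = members (map (encode l) F)

  𝓕⇒ : ∀ B → 𝓕 ∋ B → ∃[ A ] (A ∈ᴸ F × B ≡ encode l A)
  𝓕⇒ B h = ∈-map⁻ (encode l) (members⇒ (map (encode l) F) B h)

  encode∈ : ∀ A → A ∈ᴸ F → 𝓕 ∋ encode l A
  encode∈ A A∈ = members⇐ (map (encode l) F) _ (∈-map⁺ (encode l) A∈)

  encode∈⁻ : ∀ A → IsKMultiset (suc l) A → 𝓕 ∋ encode l A → A ∈ᴸ F
  encode∈⁻ A kA h with 𝓕⇒ (encode l A) h
  ... | A′ , A′∈ , e = subst (_∈ᴸ F) (sym (encode-injective l A A′ kA (All.lookup card-F A′∈) e)) A′∈

  uniform : Uniform (suc l) 𝓕
  uniform B h with 𝓕⇒ B h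
  ... | A , A∈ , refl = encode-size l A (All.lookup card-F A∈)

  unique-encode : (G : List (Multiset m)) → All (IsKMultiset (suc l)) G → Unique G → Unique (map (encode l) G)
  unique-encode []      []       []       = []
  unique-encode (A ∷ G) (kA ∷ kG) (A∉ ∷ u) =
    All.map⁺ (All.zipWith (λ { {B} (ne , kB) e → ne (encode-injective l A B kA kB e) }) (A∉ , kG))
      ∷ unique-encode G kG u

  size-𝓕 : size 𝓕 ≡ length F
  size-𝓕 = trans (size-members _ (unique-encode F card-F uniq)) (length-map (encode l) F)

  preimage : (L : List (Subset (m + l))) → All (𝓕 ∋_) L → ∃[ G ] (L ≡ map (encode l) G × All (_∈ᴸ F) G)
  preimage []      []       = [] , refl , []
  preimage (B ∷ L) (h ∷ hs) with 𝓕⇒ B h | preimage L hs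
  ... | A , A∈ , refl | G , refl , G∈ = A ∷ G , refl , A∈ ∷ G∈

  -- Disjointness of the supports only. It is weaker than `Disj`, so bounding matchings in this
  -- sense says more than `matching`; `no-extra` needs the difference.
  Apart : Subset (m + l) → Subset (m + l) → Set
  Apart A B = Disj (Vec.take m A) (Vec.take m B)

  support-matching : ∀ L → All (𝓕 ∋_) L → AllPairs Apart L → length L ≤ s
  support-matching L hs dL with preimage L hs
  ... | G , refl , G∈ = subst (_≤ s) (sym (length-map (encode l) G)) (ν G (distinct G G∈ disjoint) G∈ disjoint)
    where
    disjoint : AllPairs Disjoint G
    disjoint = AllPairs.map (λ {A} {B} d → support-disjoint A B
      (subst₂ Disj (take-++ (support A) _) (take-++ (support B) _) d)) (AllPairs.map⁻ dL)
    -- The hypothesis on `F` speaks of lists without repetition; a nonempty multiset is not disjoint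
    -- from itself.
    distinct : ∀ G → All (_∈ᴸ F) G → AllPairs Disjoint G → Unique G
    distinct []      _         _        = []
    distinct (A ∷ G) (A∈ ∷ G∈) (d ∷ ds) = All.map (λ { dA refl →
      0≢1+n (trans (sym (card-self-disjoint A dA)) (All.lookup card-F A∈)) }) d ∷ distinct G G∈ ds

  matching : Matching≤ s 𝓕
  matching L hs dL = support-matching L hs (AllPairs.map (λ {A} {B} → Disj-take m A B) dL)

  meeting-encode : (S : Subset m) (A : Multiset m) → IsKMultiset (suc l) A → IntersectsSet S A → meeting (suc l) (S ++ ∅ {l}) ∋ encode l A
  meeting-encode S A kA int = meeting-intro (suc l) (S ++ ∅) _ (encode-size l A kA)
    (λ d → intersects⇒ S A int (trans (sym (disj-++-∅ S (support A) _)) d))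

  meeting-encode⁻ : (S : Subset m) (A : Multiset m) → meeting (suc l) (S ++ ∅ {l}) ∋ encode l A → IntersectsSet S A
  meeting-encode⁻ S A h = intersects⇐ S A
    (λ d → meeting⇒¬Disj (suc l) (S ++ ∅) _ h (trans (disj-++-∅ S (support A) _) d))

  -- If S₂ contained a point x, two sets T₁ ∪ {x} and T₂ ∪ {x} with T₁, T₂ disjoint would come from disjoint
  -- multisets; together with s - 1 sets meeting S ∖ {x} they would exceed the matching number.
  no-extra : suc (2 * l) * s < m → (S₁ : Subset m) (S₂ : Subset l) → ∣ S₁ ++ S₂ ∣ ≡ s →
    (∀ B → 𝓕 B ≡ meeting (suc l) (S₁ ++ S₂) B) → S₂ ≡ ∅
  no-extra room S₁ S₂ eS extremal with ∣ S₂ ∣ in e₂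
  ... | zero  = ∣∣≡0 S₂ e₂
  ... | suc c with remove S₂ e₂
  -- Transferring into `∅` isolates the removed point of `S₂` as a singleton `x`.
  ...   | X , X⋖S₂ with transfer ∅ X⋖S₂ (Disj-∅ S₂)
  ...     | x , ∅⋖x , Xx , S₂x , _ = contradiction (support-matching _ 𝓕L apart)
      (λ le → n≮n s (subst (_≤ s) (cong suc (trans (cong suc len) sr)) le))
    where
    open ≤-Reasoning
    r = ∣ S₁ ++ X ∣
    sr : suc r ≡ s
    sr = trans (sym (⋖-size (++-⋖ S₁ X⋖S₂))) eS
    sums : ∣ S₁ ∣ + suc c ≡ s
    sums = trans (cong (∣ S₁ ∣ +_) (sym e₂)) (trans (sym (∣++∣ S₁ S₂)) eS)
    S₁≤s : ∣ S₁ ∣ ≤ s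
    S₁≤s = m+n≤o⇒m≤o ∣ S₁ ∣ (≤-reflexive sums)
    s≥1 : 1 ≤ s
    s≥1 = ≤-trans (s≤s z≤n) (≤-reflexive sr)
    few : l + (s + l) ≤ m
    few = begin
      l + (s + l)          ≡⟨ regroup l s ⟩
      2 * l * 1 + s        ≤⟨ +-monoˡ-≤ s (*-monoʳ-≤ (2 * l) s≥1) ⟩
      2 * l * s + s        ≡⟨ +-comm (2 * l * s) s ⟩
      suc (2 * l) * s      ≤⟨ <⇒≤ room ⟩
      m                    ∎
      where
      regroup : ∀ l s → l + (s + l) ≡ 2 * l * 1 + s
      regroup = solve-∀
    T₁′ = choose l S₁ (≤-trans (+-monoʳ-≤ l (≤-trans S₁≤s (m≤m+n s l))) few)
    T₁  = proj₁ T₁′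
    eT₁ = proj₁ (proj₂ T₁′)
    T₁S₁ = proj₂ (proj₂ T₁′)
    T₂′ = choose l (S₁ ∪ T₁) (begin
      l + ∣ S₁ ∪ T₁ ∣         ≤⟨ +-monoʳ-≤ l (∣∪∣≤ S₁ T₁) ⟩
      l + (∣ S₁ ∣ + ∣ T₁ ∣)   ≤⟨ +-monoʳ-≤ l (+-mono-≤ S₁≤s (≤-reflexive eT₁)) ⟩
      l + (s + l)             ≤⟨ few ⟩
      m                       ∎)
    T₂  = proj₁ T₂′
    eT₂ = proj₁ (proj₂ T₂′)
    T₂S₁ = proj₁ (Disj-∪ʳ⁻ T₂ S₁ T₁ (proj₂ (proj₂ T₂′)))
    T₂T₁ = proj₂ (Disj-∪ʳ⁻ T₂ S₁ T₁ (proj₂ (proj₂ T₂′)))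
    U = (T₁ ∪ T₂) ++ x
    ∣x∣ : ∣ x ∣ ≡ 1
    ∣x∣ = trans (⋖-size ∅⋖x) (cong suc (∣⊥∣≡0 l))
    ∣U∣ : ∣ U ∣ ≤ l + l + 1
    ∣U∣ = ≤-trans (≤-reflexive (∣++∣ (T₁ ∪ T₂) x)) (+-mono-≤
      (≤-trans (∣∪∣≤ T₁ T₂) (≤-reflexive (cong₂ _+_ eT₁ eT₂))) (≤-reflexive ∣x∣))
    -- `U` has at most `2l + 1` points because the two special sets share `x`. The blockers may use
    -- composition positions too, so all `m + l` points are available.
    blocked = blockers r l (S₁ ++ X) U refl
      (Disj-++⁺ {A = S₁} {T₁ ∪ T₂} (Disj-∪ʳ⁺ S₁ T₁ T₂ (Disj-sym {A = T₁} T₁S₁) (Disj-sym {A = T₂} T₂S₁)) Xx)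
      (begin
        r + ∣ U ∣ + r * l           ≤⟨ +-monoˡ-≤ (r * l) (+-monoʳ-≤ r ∣U∣) ⟩
        r + (l + l + 1) + r * l     ≡⟨ regroup r l ⟩
        suc r + l * suc r + l       ≡⟨ cong (λ z → z + l * z + l) sr ⟩
        s + l * s + l               ≤⟨ +-monoˡ-≤ l (+-monoʳ-≤ s (*-monoˡ-≤ s (m≤m+n l (1 * l)))) ⟩
        suc (2 * l) * s + l         ≤⟨ +-monoˡ-≤ l (<⇒≤ room) ⟩
        m + l                       ∎)
      where
      regroup : ∀ r l → r + (l + l + 1) + r * l ≡ suc r + l * suc r + l
      regroup = solve-∀
    L  = proj₁ blocked
    len = proj₁ (proj₂ blocked)
    dL = proj₁ (proj₂ (proj₂ blocked))
    uL = proj₁ (proj₂ (proj₂ (proj₂ blocked)))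
    sL = proj₁ (proj₂ (proj₂ (proj₂ (proj₂ blocked))))
    mL = proj₂ (proj₂ (proj₂ (proj₂ (proj₂ blocked))))
    in-𝓕 : ∀ B → ∣ B ∣ ≡ suc l → ¬ Disj (S₁ ++ S₂) B → 𝓕 ∋ B
    in-𝓕 B eB nd = trans (extremal B) (meeting-intro (suc l) (S₁ ++ S₂) B eB nd)
    Tx : ∀ T → ∣ T ∣ ≡ l → 𝓕 ∋ (T ++ x)
    Tx T eT = in-𝓕 (T ++ x) (trans (∣++∣ T x) (trans (cong₂ _+_ eT ∣x∣) (+-comm l 1)))
      (λ d → S₂x (proj₂ (∧-true⁻ {disj S₁ T} (trans (sym (disj-++ S₁ T S₂ x)) d))))
    𝓕L : All (𝓕 ∋_) ((T₁ ++ x) ∷ (T₂ ++ x) ∷ L)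
    𝓕L = Tx T₁ eT₁ ∷ Tx T₂ eT₂ ∷ All.zipWith
      (λ { {Z} (eZ , nZ) → in-𝓕 Z eZ (λ d → nZ (Disj-⋖ (++-⋖ S₁ X⋖S₂) d)) }) (sL , mL)
    apart : AllPairs Apart ((T₁ ++ x) ∷ (T₂ ++ x) ∷ L)
    apart = (subst₂ Disj (sym (take-++ T₁ x)) (sym (take-++ T₂ x)) (Disj-sym {A = T₂} T₂T₁)
        ∷ All.map (λ {Z} d → proj₁ (Disj-take-∪ T₁ T₂ x Z d)) uL)
      ∷ All.map (λ {Z} d → proj₂ (Disj-take-∪ T₁ T₂ x Z d)) uL
      ∷ AllPairs.map (λ {A} {B} → Disj-take m A B) dL

  extremal⇒ : suc (2 * l) * s < m → Extremal (suc l) s 𝓕 → ∃[ S ] (∣ S ∣ ≡ s × IsAllMeeting (suc l) S F)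
  extremal⇒ room (S , eS , extremal) with splitAt m S
  ... | S₁ , S₂ , refl with no-extra room S₁ S₂ eS extremal
  ...   | refl = S₁
    , trans (sym (trans (∣++∣ S₁ (∅ {l})) (trans (cong (∣ S₁ ∣ +_) (∣⊥∣≡0 l)) (+-identityʳ _)))) eS
    , λ A → (λ A∈ → All.lookup card-F A∈ ,
               meeting-encode⁻ S₁ A (trans (sym (extremal (encode l A))) (encode∈ A A∈)))
          , λ { (kA , int) → encode∈⁻ A kA (trans (extremal (encode l A)) (meeting-encode S₁ A kA int)) }

  extremal⇐ : ∀ S → ∣ S ∣ ≡ s → IsAllMeeting (suc l) S F → length F ≡ frankl-bound (m + l) (suc l) s
  extremal⇐ S eS all = trans (sym size-𝓕) (trans (∑-cong (λ B → cong 𝟙 (Bool-ext (to B) (from B))))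
    (trans (size-meeting (suc l) (S ++ ∅ {l}))
      (cong (λ z → ((m + l) C suc l) ∸ ((m + l ∸ z) C suc l))
        (trans (∣++∣ S (∅ {l})) (trans (cong (∣ S ∣ +_) (∣⊥∣≡0 l)) (trans (+-identityʳ _) eS))))))
    where
    to : ∀ B → 𝓕 ∋ B → meeting (suc l) (S ++ ∅ {l}) ∋ B
    to B h with 𝓕⇒ B h
    ... | A , A∈ , refl = meeting-encode S A (All.lookup card-F A∈) (proj₂ (proj₁ (all A) A∈))
    from : ∀ B → meeting (suc l) (S ++ ∅ {l}) ∋ B → 𝓕 ∋ B
    from B h with encode-surjective l B (meeting⇒size (suc l) (S ++ ∅) B h)
    ... | A , kA , refl = encode∈ A (proj₂ (all A) (kA , meeting-encode⁻ S A h))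

-- With `s ≤ m` the truncated subtraction commutes with adding `l`.
bound-frankl : ∀ m l s → s ≤ m → bound m (suc l) s ≡ frankl-bound (m + l) (suc l) s
bound-frankl m l s s≤m = cong₂ (λ x y → (x C suc l) ∸ (y C suc l))
  (cong (_∸ 1) (+-suc m l)) (trans (cong (_∸ 1) (+-suc (m ∸ s) l)) (sym (+-∸-comm l s≤m)))

theorem3p4 : (k m s : ℕ) → 1 ≤ k → 1 ≤ m → 1 ≤ s →
    (F : List (Multiset m)) → IsFamily m k F →
    NoMoreThanPairwiseDisjoint s F →
    (2 * k ∸ 1) * s < m →
    (length F ≤ bound m k s)
    × ((length F ≡ bound m k s) ⇔ (∃[ S ] (∣ S ∣ ≡ s × IsAllMeeting k S F)))
theorem3p4 (suc l) m s _ _ s≥1 F (uniq , card-F) ν room =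
  subst₂ _≤_ size-𝓕 (sym eq) (proj₁ result) ,
  mk⇔ (λ e → extremal⇒ room′ (proj₂ result (trans size-𝓕 (trans e eq))))
      (λ { (S , eS , all) → trans (extremal⇐ S eS all) (sym eq) })
  where
  open Transport F uniq card-F ν
  open ≤-Reasoning
  room′ : suc (2 * l) * s < m
  room′ = subst (λ z → z * s < m) (+-suc l (l + 0)) room
  -- Both sides are `2ls + l + s + 1`: the hypothesis on `m` is exactly the room condition of
  -- `frankl` on `m + l` points.
  regroup : ∀ l s → (2 * s + 1) * l + suc s ≡ suc (suc (2 * l) * s) + l
  regroup = solve-∀
  eq : bound m (suc l) s ≡ frankl-bound (m + l) (suc l) s
  eq = bound-frankl m l s (≤-trans (m≤m+n s (2 * l * s)) (<⇒≤ room′))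
  result : Frankl s l 𝓕
  result = frankl s l s≥1 (≤-trans (≤-reflexive (regroup l s)) (+-monoˡ-≤ l room′)) 𝓕 uniform matching
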